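{- Let $t>c\ge 1$ be coprime integers. Then there exists a simple planar graph $G=(V,E)$ and an edge $e\in E$ such that \[ \rho(G,e)=\frac{c}{t} \] and \[ |V|\ \le\ C\cdot \max\Big\{\frac{t}{c},\ \frac{t}{t-c},\ \log t\Big\}, \] where $C>0$ is a universal constant (independent of $t,c$).
   Context: For a connected graph $G=(V,E)$ without loops, $\tau(G)$ denotes the number of spanning trees of $G$. For an edge $e\in E$, $G/e$ denotes the graph obtained by contracting $e$ and removing all resulting loops (multiple edges are kept). The effective resistance is $\rho(G,e):=\tau(G/e)/\tau(G)$. A simple graph is one with no loops and no multiple edges. -}

module Defs where

open import Data.Nat using (ℕ; zero; suc)
open import Data.Fin using (Fin; punchOut; _≟_)
open import Data.List using (List; length; lookup; map; filter)
open import Data.Vec using (Vec; _[_]≔_) renaming (lookup to vlookup)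
open import Data.Bool using (Bool; true; false)
open import Data.Product using (Σ; ∃; _×_; _,_; proj₁; proj₂)
open import Data.Sum using (_⊎_)
open import Relation.Nullary using (¬_; yes; no; ¬?)
open import Relation.Binary.PropositionalEquality using (_≡_; _≢_; sym)
open import Function.Definitions using (Injective)
open import Data.Rational using (ℚ; 0ℚ; 1ℚ; _≤_; _+_; _*_; _-_)

-- Finite (multi)graphs on vertex set Fin n, given by a list of edges.
-- Edges are indexed by positions Fin (length G) in the list, so
-- parallel edges are allowed (needed for contractions G/e).

Edge : ℕ → Set
Edge n = Fin n × Fin n

MGraph : ℕ → Set
MGraph n = List (Edge n)

variable
  n : ℕ

Loopless : MGraph n → Set
Loopless G = ∀ i → proj₁ (lookup G i) ≢ proj₂ (lookup G i)

SameEnds : Edge n → Edge n → Set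
SameEnds (a , b) (c , d) = (a ≡ c × b ≡ d) ⊎ (a ≡ d × b ≡ c)

record Simple (G : MGraph n) : Set where
  field
    loopless : Loopless G
    noMulti  : ∀ i j → i ≢ j → ¬ SameEnds (lookup G i) (lookup G j)

EdgeSet : MGraph n → Set
EdgeSet G = Vec Bool (length G)

data Reach (G : MGraph n) (S : EdgeSet G) : Fin n → Fin n → Set where
  here : ∀ {x} → Reach G S x x
  step : ∀ {x y z} (i : Fin (length G)) → vlookup S i ≡ true →
         SameEnds (lookup G i) (x , y) → Reach G S y z → Reach G S x z

ConnectedSub : (G : MGraph n) → EdgeSet G → Set
ConnectedSub G S = ∀ x y → Reach G S x y

AcyclicSub : (G : MGraph n) → EdgeSet G → Set
AcyclicSub G S = ∀ i → vlookup S i ≡ true →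
  ¬ Reach G (S [ i ]≔ false) (proj₁ (lookup G i)) (proj₂ (lookup G i))

IsSpanningTree : (G : MGraph n) → EdgeSet G → Set
IsSpanningTree G S = ConnectedSub G S × AcyclicSub G S

HasTau : MGraph n → ℕ → Set
HasTau G k = Σ (Fin k → EdgeSet G) λ f →
  Injective _≡_ _≡_ f × (∀ j → IsSpanningTree G (f j)) ×
  (∀ S → IsSpanningTree G S → ∃ λ j → f j ≡ S)

-- Contraction G/e: identify the endpoints u, v of e (v is deleted,
-- vertices renumbered by punchOut), keep multiple edges, remove loops.

contractV : (u v : Fin (suc n)) → u ≢ v → Fin (suc n) → Fin n
contractV u v u≢v w with w ≟ v
... | yes _   = punchOut {i = v} {j = u} (λ eq → u≢v (sym eq))
... | no w≢v  = punchOut {i = v} {j = w} (λ eq → w≢v (sym eq))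

contract : (G : MGraph (suc n)) (e : Fin (length G)) →
           proj₁ (lookup G e) ≢ proj₂ (lookup G e) → MGraph n
contract G e ne =
  filter (λ ab → ¬? (proj₁ ab ≟ proj₂ ab))
         (map (λ ab → f (proj₁ ab) , f (proj₂ ab)) G)
  where f = contractV (proj₁ (lookup G e)) (proj₂ (lookup G e)) ne

-- Planarity: a straight-line crossing-free drawing with rational
-- coordinates (equivalent to planarity for simple graphs by Fáry's
-- theorem and a perturbation argument).

Point : Set
Point = ℚ × ℚ

OnSegment : Point → Point → Point → Set
OnSegment p q x = ∃ λ (l : ℚ) → 0ℚ ≤ l × l ≤ 1ℚ ×
  proj₁ x ≡ proj₁ p + l * (proj₁ q - proj₁ p) ×
  proj₂ x ≡ proj₂ p + l * (proj₂ q - proj₂ p)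

Endpoint : Fin n → Edge n → Set
Endpoint w (a , b) = w ≡ a ⊎ w ≡ b

OnEdge : (G : MGraph n) → (Fin n → Point) → Fin (length G) → Point → Set
OnEdge G pos i x = OnSegment (pos (proj₁ (lookup G i))) (pos (proj₂ (lookup G i))) x

record PlanarDrawing (G : MGraph n) (pos : Fin n → Point) : Set where
  field
    injective   : Injective _≡_ _≡_ pos
    vertexOff   : ∀ w i → ¬ Endpoint w (lookup G i) → ¬ OnEdge G pos i (pos w)
    noCrossing  : ∀ i j → i ≢ j → ∀ x → OnEdge G pos i x → OnEdge G pos j x →
                  ∃ λ w → Endpoint w (lookup G i) × Endpoint w (lookup G j) × x ≡ pos w

Planar : MGraph n → Set
Planar {n} G = Σ (Fin n → Point) (PlanarDrawing G)

{-# OPTIONS --safe #-}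
-- Removing e from G leaves a network of resistance x, and then ρ(G,e) = x/(x + 1); so one has to
-- realise x = c/(t - c).  The networks are ladders: a unit resistor in series maps x to x + 1, a
-- path of ℓ ≥ 2 edges in parallel adds 1/ℓ to 1/x.  The Euclidean algorithm on x spends a number
-- of edges equal to each partial quotient, whereas log t permits only its logarithm.  This comes
-- from the exponential distortion of unipotents in SL₂(ℤ[1/2]).  With U N = [1 N; 0 1],
-- P = [1 0; 1/2 1], Q = [1 0; 1/4 1] and D = diag(2, 1/2) one has
--   P U(4N+d+e) Q = (P U(e) D P⁻¹) (P U(N) Q) (Q⁻¹ D⁻¹ U(d) Q),
-- and for e ∈ {2,4}, d ∈ {4,8} the outer factors are themselves short ladders.  Hence a resistor
-- N between a shunt of 2 and a shunt of 4 costs O(log |N|) edges, for negative N as well; the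
-- two signs serve the partial quotients of even and of odd index.
module Submission where

open import Defs
open import Data.Bool using (Bool; true; false)
open import Data.Fin as Fin using (Fin; zero; suc; toℕ)
import Data.Fin.Properties as Finₚ
open import Data.List using (List; []; _∷_; _++_; map; length; lookup)
open import Data.List.Membership.Propositional using (_∈_)
open import Data.List.Membership.Propositional.Properties
  using (∈-map⁻; ∈-map⁺; ∈-++⁻; ∈-++⁺ˡ; ∈-++⁺ʳ; ∈-lookup)
import Data.List.Properties as Listₚ
open import Data.List.Relation.Binary.Permutation.Propositional as Perm
  using (_↭_; prep; swap; ↭-sym)
import Data.List.Relation.Binary.Permutation.Propositional.Properties as Permₚ
open import Data.List.Relation.Unary.All as All using (All; []; _∷_)
import Data.List.Relation.Unary.All.Properties as Allₚ
open import Data.List.Relation.Unary.AllPairs using (AllPairs; []; _∷_)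
import Data.List.Relation.Unary.AllPairs.Properties as AllPairsₚ
open import Data.List.Relation.Unary.Any using (here; there)
open import Data.Maybe using (Maybe; just; nothing)
open import Data.Nat as ℕ using (ℕ; zero; suc; z≤n; s≤s; z<s; >-nonZero)
open import Data.Nat.Coprimality using (Coprime)
import Data.Nat.DivMod as DivMod
open import Data.Nat.Induction using (<-rec)
open import Data.Nat.Logarithm using (⌊log₂_⌋; ⌊log₂⌋-mono-≤; ⌊log₂[2^n]⌋≡n)
import Data.Nat.Properties as ℕₚ
open import Data.Nat.Tactic.RingSolver using (solve-∀)
open import Data.Product using (Σ; ∃; ∃₂; _×_; _,_; proj₁; proj₂; uncurry)
open import Data.Rational as ℚ using (ℚ; 0ℚ; 1ℚ)
import Data.Rational.Properties as ℚₚ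
open import Data.Sum using (_⊎_; inj₁; inj₂; [_,_]′)
open import Data.Unit using (⊤; tt)
open import Data.Vec as Vec using (Vec; []; _∷_; _[_]≔_) renaming (lookup to vlookup)
open import Function using (_∘_; _on_; id; _⇔_; mk⇔; Equivalence)
open import Function.Definitions using (Injective)
open import Level using (0ℓ)
open import Relation.Binary using (Tri; tri<; tri≈; tri>)
open import Relation.Binary.PropositionalEquality
  using (_≡_; _≢_; refl; sym; trans; cong; cong₂; subst; subst₂; module ≡-Reasoning)
open import Relation.Nullary using (¬_; Dec; yes; no; contradiction; ¬?)
import Tactic.RingSolver as RingSolver
open import Tactic.RingSolver.Core.AlmostCommutativeRing using (AlmostCommutativeRing; fromCommutativeRing)

open Equivalence using (to; from)

-- Connectivity and spanning trees

-- A single edge used as a shunt would be parallel to `e`, so the shortest shunt has two edges and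
-- conductance 1/2; integer conductances are made of such halves. The sums d + e are 6, 8, 10, 12,
-- which meet every even residue modulo 8, so the recursion reaches all large even N. A ladder
-- cannot simply be closed by the Euclidean remainder: its last shunt of 4 also acts on the load,
-- and to show the value y it needs the load 4y/(4 - y). Dividing by 2r instead of r keeps y between
-- 1 and 3, hence the load between 4/3 and 12, so that the recursion stays in a fixed range; the
-- price is a new denominator of up to 3r. The accounting is by binary digits of the denominator: a
-- quotient near 4^κ costs 16κ vertices plus a constant and removes 2κ - 1 digits, and 400 vertices
-- per digit pay for this. Fractions are kept unreduced over ℕ; even the negative resistors act by
-- matrices that become nonnegative after a common change of sign.

private variable
  V W : Set

data Conn {V : Set} (F : List (V × V)) : V → V → Set where
  done : ∀ {x} → Conn F x x
  fwd  : ∀ {x y z} → (x , y) ∈ F → Conn F y z → Conn F x z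
  bwd  : ∀ {x y z} → (y , x) ∈ F → Conn F y z → Conn F x z

edge : ∀ {F : List (V × V)} {x y} → (x , y) ∈ F → Conn F x y
edge e = fwd e done

conn-trans : ∀ {F : List (V × V)} {x y z} → Conn F x y → Conn F y z → Conn F x z
conn-trans done      q = q
conn-trans (fwd e p) q = fwd e (conn-trans p q)
conn-trans (bwd e p) q = bwd e (conn-trans p q)

conn-sym : ∀ {F : List (V × V)} {x y} → Conn F x y → Conn F y x
conn-sym done      = done
conn-sym (fwd e p) = conn-trans (conn-sym p) (bwd e done)
conn-sym (bwd e p) = conn-trans (conn-sym p) (fwd e done)

conn-bind : ∀ {F : List (V × V)} {F′ : List (W × W)} (φ : V → W) →
            (∀ {a b} → (a , b) ∈ F → Conn F′ (φ a) (φ b)) →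
            ∀ {x y} → Conn F x y → Conn F′ (φ x) (φ y)
conn-bind φ h done      = done
conn-bind φ h (fwd e p) = conn-trans (h e) (conn-bind φ h p)
conn-bind φ h (bwd e p) = conn-trans (conn-sym (h e)) (conn-bind φ h p)

conn-mono : ∀ {F F′ : List (V × V)} → (∀ {e} → e ∈ F → e ∈ F′) →
            ∀ {x y} → Conn F x y → Conn F′ x y
conn-mono h = conn-bind id (edge ∘ h)

-- All passages of a path along `(u , v)` collapse to at most one. This is the exchange property
-- behind the independence of `Acyclic` from the order of the list.
conn-exchange : ∀ {F : List (V × V)} {u v x y} → Conn ((u , v) ∷ F) x y →
                Conn F x y ⊎ (Conn F x u × Conn F v y) ⊎ (Conn F x v × Conn F u y)
conn-exchange done = inj₁ done
conn-exchange (fwd (here refl) p) with conn-exchange p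
... | inj₁ q              = inj₂ (inj₁ (done , q))
... | inj₂ (inj₁ (_ , q)) = inj₂ (inj₁ (done , q))
... | inj₂ (inj₂ (_ , q)) = inj₁ q
conn-exchange (bwd (here refl) p) with conn-exchange p
... | inj₁ q              = inj₂ (inj₂ (done , q))
... | inj₂ (inj₁ (_ , q)) = inj₁ q
... | inj₂ (inj₂ (_ , q)) = inj₂ (inj₂ (done , q))
conn-exchange (fwd (there e) p) with conn-exchange p
... | inj₁ q              = inj₁ (fwd e q)
... | inj₂ (inj₁ (r , q)) = inj₂ (inj₁ (fwd e r , q))
... | inj₂ (inj₂ (r , q)) = inj₂ (inj₂ (fwd e r , q))
conn-exchange (bwd (there e) p) with conn-exchange p
... | inj₁ q              = inj₁ (bwd e q)
... | inj₂ (inj₁ (r , q)) = inj₂ (inj₁ (bwd e r , q))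
... | inj₂ (inj₂ (r , q)) = inj₂ (inj₂ (bwd e r , q))

-- Recursive in the list, so that putting an edge in front is a single step; `acyclic-↭` shows that
-- the order does not matter.
Acyclic : List (V × V) → Set
Acyclic []            = ⊤
Acyclic ((x , y) ∷ F) = ¬ Conn F x y × Acyclic F

no-cycle-swap : ∀ {F : List (V × V)} {u v x y} →
                ¬ Conn ((u , v) ∷ F) x y → ¬ Conn F u v → ¬ Conn ((x , y) ∷ F) u v
no-cycle-swap n m p with conn-exchange p
... | inj₁ q              = m q
... | inj₂ (inj₁ (r , s)) =
  n (conn-trans (conn-sym (conn-mono there r)) (fwd (here refl) (conn-sym (conn-mono there s))))
... | inj₂ (inj₂ (r , s)) =
  n (conn-trans (conn-mono there s) (bwd (here refl) (conn-mono there r)))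

acyclic-↭ : ∀ {F F′ : List (V × V)} → F ↭ F′ → Acyclic F → Acyclic F′
acyclic-↭ Perm.refl a = a
acyclic-↭ (prep e p) (n , a) =
  (λ c → n (conn-mono (Permₚ.∈-resp-↭ (↭-sym p)) c)) , acyclic-↭ p a
acyclic-↭ (swap e f p) (n , m , a) =
  (λ c → no-cycle-swap n m (conn-mono (Permₚ.∈-resp-↭ (prep _ (↭-sym p))) c)) ,
  (λ c → n (conn-mono (there ∘ Permₚ.∈-resp-↭ (↭-sym p)) c)) , acyclic-↭ p a
acyclic-↭ (Perm.trans p q) a = acyclic-↭ q (acyclic-↭ p a)

-- `A` carves the vertex set out of `V`: everything for `Fin n`, an initial segment for numbered
-- networks.
Tree : (V → Set) → List (V × V) → Set
Tree A F = (∀ {x y} → A x → A y → Conn F x y) × Acyclic F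

tree-↭ : ∀ {A : V → Set} {F F′} → F ↭ F′ → Tree A F → Tree A F′
tree-↭ p (c , a) = (λ ax ay → conn-mono (Permₚ.∈-resp-↭ p) (c ax ay)) , acyclic-↭ p a

-- Identifying vertices along φ amounts to adding edges L that connect exactly the fibres.
module Quotient {V W : Set} (φ : V → W) (σ : W → V) (L : List (V × V))
  (L-fibre : ∀ {a b} → (a , b) ∈ L → φ a ≡ φ b)
  (L-conn : ∀ x → Conn L x (σ (φ x)))
  (L-acyclic : Acyclic L) where

  φ² : V × V → W × W
  φ² (a , b) = φ a , φ b

  conn-push : ∀ F {x y} → Conn (L ++ F) x y → Conn (map φ² F) (φ x) (φ y)
  conn-push F = conn-bind φ λ {a} {b} e → push (∈-++⁻ L e)
    where
    push : ∀ {a b} → (a , b) ∈ L ⊎ (a , b) ∈ F → Conn (map φ² F) (φ a) (φ b)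
    push {a} (inj₁ e) = subst (Conn (map φ² F) (φ a)) (L-fibre e) done
    push     (inj₂ e) = edge (∈-map⁺ φ² e)

  conn-section : ∀ F x → Conn (L ++ F) x (σ (φ x))
  conn-section F x = conn-mono ∈-++⁺ˡ (L-conn x)

  conn-lift : ∀ F {x y} → Conn (map φ² F) x y → Conn (L ++ F) (σ x) (σ y)
  conn-lift F = conn-bind σ lift
    where
    lift : ∀ {a b} → (a , b) ∈ map φ² F → Conn (L ++ F) (σ a) (σ b)
    lift e with ∈-map⁻ φ² e
    ... | (a , b) , e′ , refl =
      conn-trans (conn-sym (conn-section F a)) (fwd (∈-++⁺ʳ L e′) (conn-section F b))

  conn-pull : ∀ F {x y} → Conn (map φ² F) (φ x) (φ y) → Conn (L ++ F) x y
  conn-pull F {x} {y} c =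
    conn-trans (conn-section F x) (conn-trans (conn-lift F c) (conn-sym (conn-section F y)))

  acyclic-push : ∀ F → Acyclic (L ++ F) → Acyclic (map φ² F)
  acyclic-push []      _ = tt
  acyclic-push (f ∷ F) a with acyclic-↭ (Permₚ.shift f L F) a
  ... | n , a′ = n ∘ conn-pull F , acyclic-push F a′

  acyclic-pull : ∀ F → Acyclic (map φ² F) → Acyclic (L ++ F)
  acyclic-pull []      _       = subst Acyclic (sym (Listₚ.++-identityʳ L)) L-acyclic
  acyclic-pull (f ∷ F) (n , a) =
    acyclic-↭ (↭-sym (Permₚ.shift f L F)) (n ∘ conn-push F , acyclic-pull F a)

  -- Serves for two quotients: with one edge in `L` it is the contraction of that edge, with `L`
  -- empty the renumbering of vertices.
  tree-quotient : {A : V → Set} {B : W → Set} → (∀ {x} → A x → B (φ x)) →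
                  (∀ {y} → B y → ∃ λ x → A x × φ x ≡ y) →
                  ∀ F → Tree B (map φ² F) ⇔ Tree A (L ++ F)
  tree-quotient A⇒B B⇒A F = mk⇔
    (λ (c , a) → (λ ax ay → conn-pull F (c (A⇒B ax) (A⇒B ay))) , acyclic-pull F a)
    (λ (c , a) → (λ bx by → joined c (B⇒A bx) (B⇒A by)) , acyclic-push F a)
    where
    joined : (∀ {x y} → _ → _ → Conn (L ++ F) x y) → ∀ {x y} →
             (∃ λ x′ → _ × φ x′ ≡ x) → (∃ λ y′ → _ × φ y′ ≡ y) → Conn (map φ² F) x y
    joined c (_ , ax , refl) (_ , ay , refl) = conn-push F (c ax ay)

-- Sets of edges, their spanning trees and their number

select : ∀ {A : Set} (G : List A) → Vec Bool (length G) → List A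
select []      []          = []
select (x ∷ G) (true ∷ S)  = x ∷ select G S
select (x ∷ G) (false ∷ S) = select G S

select-All : ∀ {A : Set} {P : A → Set} {G} → All P G → ∀ S → All P (select G S)
select-All []       []          = []
select-All (p ∷ ps) (true ∷ S)  = p ∷ select-All ps S
select-All (p ∷ ps) (false ∷ S) = select-All ps S

∈-select⁺ : ∀ {A : Set} (G : List A) S i → vlookup S i ≡ true → lookup G i ∈ select G S
∈-select⁺ (x ∷ G) (true ∷ S)  zero    _ = here refl
∈-select⁺ (x ∷ G) (true ∷ S)  (suc i) h = there (∈-select⁺ G S i h)
∈-select⁺ (x ∷ G) (false ∷ S) (suc i) h = ∈-select⁺ G S i h

∈-select⁻ : ∀ {A : Set} (G : List A) S {e} → e ∈ select G S →
            ∃ λ i → vlookup S i ≡ true × lookup G i ≡ e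
∈-select⁻ []      []         ()
∈-select⁻ (x ∷ G) (true ∷ S) (here refl) = zero , refl , refl
∈-select⁻ (x ∷ G) (true ∷ S) (there h) with ∈-select⁻ G S h
... | i , p , q = suc i , p , q
∈-select⁻ (x ∷ G) (false ∷ S) h with ∈-select⁻ G S h
... | i , p , q = suc i , p , q

module _ {n : ℕ} (G : MGraph n) where
  reach⇒conn : ∀ S {x y} → Reach G S x y → Conn (select G S) x y
  reach⇒conn S here = done
  reach⇒conn S (step i h (inj₁ (refl , refl)) r) = fwd (∈-select⁺ G S i h) (reach⇒conn S r)
  reach⇒conn S (step i h (inj₂ (refl , refl)) r) = bwd (∈-select⁺ G S i h) (reach⇒conn S r)

  conn⇒reach : ∀ S {x y} → Conn (select G S) x y → Reach G S x y
  conn⇒reach S done = here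
  conn⇒reach S (fwd e c) with ∈-select⁻ G S e
  ... | i , h , refl = step i h (inj₁ (refl , refl)) (conn⇒reach S c)
  conn⇒reach S (bwd e c) with ∈-select⁻ G S e
  ... | i , h , refl = step i h (inj₂ (refl , refl)) (conn⇒reach S c)

NoRedundant : ∀ {n} (G : MGraph n) → EdgeSet G → Set
NoRedundant G S = ∀ i → vlookup S i ≡ true →
  ¬ Conn (select G (S [ i ]≔ false)) (proj₁ (lookup G i)) (proj₂ (lookup G i))

noRedundant⇒acyclic : ∀ {n} (G : MGraph n) S → NoRedundant G S → Acyclic (select G S)
noRedundant⇒acyclic []      []          h = tt
noRedundant⇒acyclic (e ∷ G) (true ∷ S)  h =
  h zero refl , noRedundant⇒acyclic G S (λ i p → h (suc i) p ∘ conn-mono there)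
noRedundant⇒acyclic (e ∷ G) (false ∷ S) h = noRedundant⇒acyclic G S (h ∘ suc)

select-remove : ∀ {A : Set} (G : List A) S i → vlookup S i ≡ true →
                select G S ↭ lookup G i ∷ select G (S [ i ]≔ false)
select-remove (x ∷ G) (true ∷ S)  zero    _ = Perm.refl
select-remove (x ∷ G) (true ∷ S)  (suc i) h =
  Perm.trans (prep x (select-remove G S i h)) (swap x _ Perm.refl)
select-remove (x ∷ G) (false ∷ S) (suc i) h = select-remove G S i h

-- Any chosen edge can be moved to the front of the list, where `Acyclic` speaks about it directly.
acyclic⇒noRedundant : ∀ {n} (G : MGraph n) S → Acyclic (select G S) → NoRedundant G S
acyclic⇒noRedundant G S a i h = proj₁ (acyclic-↭ (select-remove G S i h) a)

spanningTree⇔tree : ∀ {n} (G : MGraph n) S →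
                    IsSpanningTree G S ⇔ Tree (λ _ → ⊤) (select G S)
spanningTree⇔tree G S = mk⇔
  (λ (c , a) → (λ {x} {y} _ _ → reach⇒conn G S (c x y)) ,
               noRedundant⇒acyclic G S (λ i h → a i h ∘ conn⇒reach G _))
  (λ (c , a) → (λ x y → conn⇒reach G S (c tt tt)) ,
               (λ i h → acyclic⇒noRedundant G S a i h ∘ reach⇒conn G _))

-- The shape of `HasTau` for an arbitrary predicate on bit vectors, so that counts can be added and
-- transported along bijections.
Count : ∀ {m} → (Vec Bool m → Set) → ℕ → Set
Count {m} P k = Σ (Fin k → Vec Bool m) λ f →
  Injective _≡_ _≡_ f × (∀ j → P (f j)) × (∀ S → P S → ∃ λ j → f j ≡ S)

module _ {m m′} {P : Vec Bool m → Set} {Q : Vec Bool m′ → Set}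
  (α : Vec Bool m → Vec Bool m′) (β : Vec Bool m′ → Vec Bool m)
  (αβ : ∀ S → α (β S) ≡ S) (βα : ∀ S → β (α S) ≡ S)
  (P⇔Q : ∀ S → P S ⇔ Q (α S)) where

  count-bij : ∀ {k} → Count P k → Count Q k
  count-bij (f , inj , all , cover) =
    α ∘ f ,
    (λ {i} {j} e → inj (trans (sym (βα (f i))) (trans (cong β e) (βα (f j))))) ,
    (λ j → to (P⇔Q (f j)) (all j)) ,
    λ S q → let j , e = cover (β S) (from (P⇔Q (β S)) (subst Q (sym (αβ S)) q))
            in j , trans (cong α e) (αβ S)

count-⇔ : ∀ {m} {P Q : Vec Bool m → Set} → (∀ S → P S ⇔ Q S) → ∀ {k} → Count P k → Count Q k
count-⇔ = count-bij id id (λ _ → refl) (λ _ → refl)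

count-none : ∀ {m} {P : Vec Bool m → Set} → (∀ S → ¬ P S) → Count P 0
count-none h = (λ ()) , (λ { {()} }) , (λ ()) , (λ S p → contradiction p (h S))

count-[] : {P : Vec Bool 0 → Set} → P [] → Count P 1
count-[] p = (λ _ → []) , (λ { {zero} {zero} _ → refl }) , (λ _ → p) , λ { [] _ → zero , refl }

count-∷ : ∀ {m} {P : Vec Bool (suc m) → Set} {a b} →
          Count (P ∘ (true ∷_)) a → Count (P ∘ (false ∷_)) b → Count P (a ℕ.+ b)
count-∷ {m} {P} {a} {b} (f , f-inj , f-all , f-cover) (g , g-inj , g-all , g-cover) =
  h , h-inj , h-all , h-cover
  where
  h⊎ : Fin a ⊎ Fin b → Vec Bool (suc m)
  h⊎ = [ (true ∷_) ∘ f , (false ∷_) ∘ g ]′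

  h⊎-inj : ∀ x y → h⊎ x ≡ h⊎ y → x ≡ y
  h⊎-inj (inj₁ i) (inj₁ j) e = cong inj₁ (f-inj (cong Vec.tail e))
  h⊎-inj (inj₂ i) (inj₂ j) e = cong inj₂ (g-inj (cong Vec.tail e))
  h⊎-inj (inj₁ i) (inj₂ j) e with cong Vec.head e
  ... | ()
  h⊎-inj (inj₂ i) (inj₁ j) e with cong Vec.head e
  ... | ()

  h : Fin (a ℕ.+ b) → Vec Bool (suc m)
  h = h⊎ ∘ Fin.splitAt a

  h-join : ∀ x → h (Fin.join a b x) ≡ h⊎ x
  h-join x = cong h⊎ (Finₚ.splitAt-join a b x)

  h-inj : Injective _≡_ _≡_ h
  h-inj {i} {j} e = trans (sym (Finₚ.join-splitAt a b i))
    (trans (cong (Fin.join a b) (h⊎-inj (Fin.splitAt a i) (Fin.splitAt a j) e)) (Finₚ.join-splitAt a b j))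

  h-all : ∀ j → P (h j)
  h-all j with Fin.splitAt a j
  ... | inj₁ i = f-all i
  ... | inj₂ i = g-all i

  h-cover : ∀ S → P S → ∃ λ j → h j ≡ S
  h-cover (true ∷ S) p with f-cover S p
  ... | i , refl = Fin.join a b (inj₁ i) , h-join (inj₁ i)
  h-cover (false ∷ S) p with g-cover S p
  ... | i , refl = Fin.join a b (inj₂ i) , h-join (inj₂ i)

module _ {A B : Set} (f : A → B) where
  -- `length (map f G)` does not reduce to `length G`, so bit vectors are carried over by recursion
  -- on the list instead of a cast.
  sub↑ : (G : List A) → Vec Bool (length G) → Vec Bool (length (map f G))
  sub↑ []      S       = S
  sub↑ (x ∷ G) (b ∷ S) = b ∷ sub↑ G S

  sub↓ : (G : List A) → Vec Bool (length (map f G)) → Vec Bool (length G)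
  sub↓ []      S       = S
  sub↓ (x ∷ G) (b ∷ S) = b ∷ sub↓ G S

  sub↑↓ : ∀ G S → sub↑ G (sub↓ G S) ≡ S
  sub↑↓ []      S       = refl
  sub↑↓ (x ∷ G) (b ∷ S) = cong (b ∷_) (sub↑↓ G S)

  sub↓↑ : ∀ G S → sub↓ G (sub↑ G S) ≡ S
  sub↓↑ []      S       = refl
  sub↓↑ (x ∷ G) (b ∷ S) = cong (b ∷_) (sub↓↑ G S)

  select-map : ∀ G S → select (map f G) (sub↑ G S) ≡ map f (select G S)
  select-map []      []          = refl
  select-map (x ∷ G) (true ∷ S)  = cong (f x ∷_) (select-map G S)
  select-map (x ∷ G) (false ∷ S) = select-map G S

  module _ (P : List B → Set) (Q : List A → Set) (P⇔Q : ∀ F → P (map f F) ⇔ Q F) where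
    private
      equiv : ∀ G S → P (select (map f G) (sub↑ G S)) ⇔ Q (select G S)
      equiv G S = subst (λ F → P F ⇔ Q (select G S)) (sym (select-map G S)) (P⇔Q (select G S))

    count-map⁻ : ∀ G {k} → Count (P ∘ select (map f G)) k → Count (Q ∘ select G) k
    count-map⁻ G = count-bij (sub↓ G) (sub↑ G) (sub↓↑ G) (sub↑↓ G) λ S →
      subst (λ S′ → P (select (map f G) S′) ⇔ Q (select G (sub↓ G S))) (sub↑↓ G S)
        (equiv G (sub↓ G S))

    count-map⁺ : ∀ G {k} → Count (Q ∘ select G) k → Count (P ∘ select (map f G)) k
    count-map⁺ G = count-bij (sub↑ G) (sub↓ G) (sub↑↓ G) (sub↓↑ G) λ S →
      mk⇔ (from (equiv G S)) (to (equiv G S))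

hasTau : ∀ {n} (G : MGraph n) {k} → Count (λ S → Tree (λ _ → ⊤) (select G S)) k → HasTau G k
hasTau G = count-⇔ λ S → let s = spanningTree⇔tree G S in mk⇔ (from s) (to s)

-- Contraction of an edge

conn-singleton : ∀ {V : Set} {u v x y : V} → Conn ((u , v) ∷ []) x y →
                 x ≡ y ⊎ (x ≡ u × y ≡ v) ⊎ (x ≡ v × y ≡ u)
conn-singleton c with conn-exchange c
... | inj₁ done                 = inj₁ refl
... | inj₂ (inj₁ (done , done)) = inj₂ (inj₁ (refl , refl))
... | inj₂ (inj₂ (done , done)) = inj₂ (inj₂ (refl , refl))

module Contraction {n} (u v : Fin (suc n)) (u≢v : u ≢ v) where
  φ : Fin (suc n) → Fin n
  φ = contractV u v u≢v

  φ-v : φ v ≡ Fin.punchOut (u≢v ∘ sym)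
  φ-v with v Fin.≟ v
  ... | yes _  = refl
  ... | no v≢v = contradiction refl v≢v

  φ-other : ∀ {w} (w≢v : w ≢ v) → φ w ≡ Fin.punchOut (w≢v ∘ sym)
  φ-other {w} w≢v with w Fin.≟ v
  ... | yes w≡v = contradiction w≡v w≢v
  ... | no _    = Finₚ.punchOut-cong v refl

  φ-u≡φ-v : φ u ≡ φ v
  φ-u≡φ-v = trans (φ-other u≢v) (sym φ-v)

  φ-punchIn : ∀ y → φ (Fin.punchIn v y) ≡ y
  φ-punchIn y = trans (φ-other (Finₚ.punchInᵢ≢i v y)) (Finₚ.punchOut-punchIn v)

  punchIn-φ : ∀ x → Conn ((u , v) ∷ []) x (Fin.punchIn v (φ x))
  punchIn-φ x with x Fin.≟ v
  ... | yes refl = subst (Conn _ v) (sym (Finₚ.punchIn-punchOut (u≢v ∘ sym))) (bwd (here refl) done)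
  ... | no x≢v   = subst (Conn _ x) (sym (Finₚ.punchIn-punchOut (x≢v ∘ sym))) done

  φ-fibre : ∀ {a b} → (a , b) ∈ (u , v) ∷ [] → φ a ≡ φ b
  φ-fibre (here refl) = φ-u≡φ-v

  edge-acyclic : Acyclic ((u , v) ∷ [])
  edge-acyclic = (λ { done → u≢v refl }) , tt

  open Quotient φ (Fin.punchIn v) ((u , v) ∷ []) φ-fibre punchIn-φ edge-acyclic public

  NotLoop : Edge (suc n) → Set
  NotLoop e = proj₁ e ≢ proj₂ e × ¬ SameEnds e (u , v)

  -- Equal images are connected by no edges at all in the quotient, hence upstairs by the contracted
  -- edge alone.
  φ-notLoop : ∀ {e} → NotLoop e → φ (proj₁ e) ≢ φ (proj₂ e)
  φ-notLoop {a , b} (a≢b , ¬same) eq with conn-singleton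
    (conn-pull [] {a} {b} (subst (Conn [] (φ a)) eq done))
  ... | inj₁ a≡b             = a≢b a≡b
  ... | inj₂ (inj₁ (p , q))  = ¬same (inj₁ (p , q))
  ... | inj₂ (inj₂ (p , q))  = ¬same (inj₂ (p , q))

  contract-head : ∀ {G} → All NotLoop G → contract ((u , v) ∷ G) zero u≢v ≡ map φ² G
  contract-head {G} ok = trans
    (Listₚ.filter-reject (λ ab → ¬? (proj₁ ab Fin.≟ proj₂ ab)) (λ ne → ne φ-u≡φ-v))
    (Listₚ.filter-all _ (Allₚ.map⁺ (All.map φ-notLoop ok)))

  hasTau-contract : ∀ {G} → All NotLoop G → ∀ {k} →
                    Count (λ S → Tree (λ _ → ⊤) ((u , v) ∷ select G S)) k →
                    HasTau (contract ((u , v) ∷ G) zero u≢v) k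
  hasTau-contract {G} ok t = subst (λ H → HasTau H _) (sym (contract-head ok))
    (hasTau (map φ² G) (count-map⁺ φ² (Tree (λ _ → ⊤)) (λ F → Tree (λ _ → ⊤) ((u , v) ∷ F))
      (tree-quotient (λ _ → tt) (λ {y} _ → Fin.punchIn v y , tt , φ-punchIn y)) G t))

-- Links between numbered vertices

Link : Set
Link = ℕ × ℕ

Within : ℕ → Link → Set
Within n (m , p) = m ℕ.< n × p ℕ.< n

Tree< : ℕ → List Link → Set
Tree< n = Tree (ℕ._< n)

Good : ℕ → Link → Set
Good n (m , p) = p ℕ.< m × m ℕ.< n

-- Links to 0 are star edges, all others tree edges.  Visible a e says that the tree edge e
-- does not separate the vertex a from later vertices in the upper half plane.
Visible : ℕ → Link → Set
Visible a (m , zero)  = ⊤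
Visible a (m , suc p) = a ℕ.≤ suc p ⊎ m ℕ.≤ a

-- Directed from a newer link to an older one: a new tree edge starts at a larger vertex, and its
-- chord either encloses the older chord or lies to the right of it.
Compatible : Link → Link → Set
Compatible (m , zero)  (m′ , zero)   = m ≢ m′
Compatible (m , zero)  (m′ , suc p′) = ⊤
Compatible (m , suc p) (m′ , zero)   = ⊤
Compatible (m , suc p) (m′ , suc p′) = m′ ℕ.< m × Visible (suc p) (m′ , suc p′)

good⇒within : ∀ {n e} → Good n e → Within n e
good⇒within (p<m , m<n) = m<n , ℕₚ.<-trans p<m m<n

good-suc : ∀ {n e} → Good n e → Good (suc n) e
good-suc (p<m , m<n) = p<m , ℕₚ.m<n⇒m<1+n m<n

visible-top : ∀ {n e} → Good n e → Visible n e
visible-top {e = m , zero}  g         = tt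
visible-top {e = m , suc p} (_ , m<n) = inj₂ (ℕₚ.<⇒≤ m<n)

compatible-star : ∀ {n e} → Good n e → Compatible (n , 0) e
compatible-star {e = m , zero}  (_ , m<n) = λ n≡m → ℕₚ.<-irrefl (sym n≡m) m<n
compatible-star {e = m , suc p} g         = tt

compatible-tree : ∀ {n a e} → Good n e → Visible (suc a) e → Compatible (n , suc a) e
compatible-tree {e = m , zero}  g         v = tt
compatible-tree {e = m , suc p} (_ , m<n) v = m<n , v

-- `Quotient` wants a map back that is defined on all of ℕ; numbers above `n` go to the last vertex.
clamp : ∀ n → ℕ → Fin (suc n)
clamp n       zero    = zero
clamp zero    (suc x) = zero
clamp (suc n) (suc x) = suc (clamp n x)

clamp-toℕ : ∀ {n} (x : Fin (suc n)) → clamp n (toℕ x) ≡ x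
clamp-toℕ         zero    = refl
clamp-toℕ {suc n} (suc x) = cong suc (clamp-toℕ x)

module Numbering (n : ℕ) where
  toℕ-fibre : ∀ {a b : Fin (suc n)} → (a , b) ∈ [] → toℕ a ≡ toℕ b
  toℕ-fibre ()

  clamp-conn : ∀ x → Conn [] x (clamp n (toℕ x))
  clamp-conn x = subst (Conn [] x) (sym (clamp-toℕ x)) done

  open Quotient (toℕ {suc n}) (clamp n) [] toℕ-fibre clamp-conn tt
    public renaming (φ² to toℕ²)

  tree-toℕ : ∀ F → Tree< (suc n) (map toℕ² F) ⇔ Tree (λ _ → ⊤) F
  tree-toℕ = tree-quotient (λ {x} _ → Finₚ.toℕ<n x) (λ y<n → Fin.fromℕ< y<n , tt , Finₚ.toℕ-fromℕ< y<n)

  number : ∀ {G} → All (Within (suc n)) G → ∃ λ H → map toℕ² H ≡ G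
  number []              = [] , refl
  number ((a , b) ∷ ws) with number ws
  ... | H , refl = (Fin.fromℕ< a , Fin.fromℕ< b) ∷ H ,
    cong (_∷ map toℕ² H) (cong₂ _,_ (Finₚ.toℕ-fromℕ< a) (Finₚ.toℕ-fromℕ< b))

allPairs-lookup : ∀ {A : Set} {R : A → A → Set} {xs} → AllPairs R xs → ∀ i j → i ≢ j →
                  R (lookup xs i) (lookup xs j) ⊎ R (lookup xs j) (lookup xs i)
allPairs-lookup (r ∷ rs) zero    zero    i≢j = contradiction refl i≢j
allPairs-lookup (r ∷ rs) zero    (suc j) i≢j = inj₁ (All.lookup r (∈-lookup j))
allPairs-lookup (r ∷ rs) (suc i) zero    i≢j = inj₂ (All.lookup r (∈-lookup i))
allPairs-lookup (r ∷ rs) (suc i) (suc j) i≢j = allPairs-lookup rs i j (i≢j ∘ cong suc)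

compatible-irrefl : ∀ {e} → ¬ Compatible e e
compatible-irrefl {m , zero}  m≢m       = m≢m refl
compatible-irrefl {m , suc p} (m<m , _) = ℕₚ.<-irrefl refl m<m

module _ {n : ℕ} where
  open Numbering n

  compatible-distinct : ∀ {e f} → Good (suc n) (toℕ² e) → Good (suc n) (toℕ² f) →
                        Compatible (toℕ² e) (toℕ² f) → ¬ SameEnds e f
  compatible-distinct (p<m , _) (q<k , _) c (inj₁ (refl , refl)) = compatible-irrefl c
  compatible-distinct (p<m , _) (q<k , _) c (inj₂ (refl , refl)) = ℕₚ.<-asym p<m q<k

  sameEnds-sym : ∀ {e f : Edge (suc n)} → SameEnds e f → SameEnds f e
  sameEnds-sym (inj₁ (p , q)) = inj₁ (sym p , sym q)
  sameEnds-sym (inj₂ (p , q)) = inj₂ (sym q , sym p)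

  good-loopless : ∀ {e} → Good (suc n) (toℕ² e) → proj₁ e ≢ proj₂ e
  good-loopless (p<m , _) refl = ℕₚ.<-irrefl refl p<m

  simple : ∀ {H : MGraph (suc n)} → All (Good (suc n) ∘ toℕ²) H → AllPairs (Compatible on toℕ²) H → Simple H
  simple {H} good compatible = record
    { loopless = λ i → good-loopless (good-at i)
    ; noMulti  = λ i j i≢j → [ compatible-distinct (good-at i) (good-at j)
                             , (λ c → compatible-distinct (good-at j) (good-at i) c ∘ sameEnds-sym) ]′
                             (allPairs-lookup compatible i j i≢j) }
    where
    good-at : ∀ i → Good (suc n) (toℕ² (lookup H i))
    good-at i = All.lookup good (∈-lookup i)

-- A straight-line drawing

module Plane where

  open import Data.Rational using (_+_; _*_; _-_; -_; _≤_; _<_)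

  ℚ-ring : AlmostCommutativeRing 0ℓ 0ℓ
  ℚ-ring = fromCommutativeRing ℚₚ.+-*-commutativeRing isZero
    where
    isZero : ∀ x → Maybe (0ℚ ≡ x)
    isZero x with 0ℚ ℚ.≟ x
    ... | yes p = just p
    ... | no _  = nothing

  ≤⇒0≤- : ∀ {a b} → a ≤ b → 0ℚ ≤ b - a
  ≤⇒0≤- {a} {b} a≤b = subst (_≤ b - a) (ℚₚ.+-inverseʳ a) (ℚₚ.+-monoˡ-≤ (- a) a≤b)

  <⇒0<- : ∀ {a b} → a < b → 0ℚ < b - a
  <⇒0<- {a} {b} a<b = subst (_< b - a) (ℚₚ.+-inverseʳ a) (ℚₚ.+-monoˡ-< (- a) a<b)

  0≤-⇒≤ : ∀ {a b} → 0ℚ ≤ b - a → a ≤ b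
  0≤-⇒≤ {a} {b} h = subst₂ _≤_ (ℚₚ.+-identityˡ a) (cancel a b) (ℚₚ.+-monoˡ-≤ a h)
    where
    cancel : ∀ a b → b - a + a ≡ b
    cancel = RingSolver.solve-∀ ℚ-ring

  0≤* : ∀ {a b} → 0ℚ ≤ a → 0ℚ ≤ b → 0ℚ ≤ a * b
  0≤* {a} {b} p q = ℚₚ.nonNegative⁻¹ (a * b)
    {{ℚₚ.nonNeg*nonNeg⇒nonNeg a {{ℚ.nonNegative p}} b {{ℚ.nonNegative q}}}}

  0<* : ∀ {a b} → 0ℚ < a → 0ℚ < b → 0ℚ < a * b
  0<* {a} {b} p q = ℚₚ.positive⁻¹ (a * b) {{ℚₚ.pos*pos⇒pos a {{ℚ.positive p}} b {{ℚ.positive q}}}}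

  ≤-*-mono : ∀ {a b} c → 0ℚ ≤ c → a ≤ b → c * a ≤ c * b
  ≤-*-mono c p = ℚₚ.*-monoˡ-≤-nonNeg c {{ℚ.nonNegative p}}

  ≡0-cancelʳ : ∀ {a b} → 0ℚ < b → a * b ≡ 0ℚ → a ≡ 0ℚ
  ≡0-cancelʳ {a} {b} 0<b ab≡0 = ℚₚ.≤-antisym
    (ℚₚ.*-cancelʳ-≤-pos b {{ℚ.positive 0<b}} (ℚₚ.≤-reflexive (trans ab≡0 (sym (ℚₚ.*-zeroˡ b)))))
    (ℚₚ.*-cancelʳ-≤-pos b {{ℚ.positive 0<b}} (ℚₚ.≤-reflexive (trans (ℚₚ.*-zeroˡ b) (sym ab≡0))))

  sum≡0ˡ : ∀ {a b} → 0ℚ ≤ a → 0ℚ ≤ b → a + b ≡ 0ℚ → a ≡ 0ℚ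
  sum≡0ˡ {a} {b} p q e = ℚₚ.≤-antisym
    (subst₂ _≤_ (ℚₚ.+-identityʳ a) e (ℚₚ.+-monoʳ-≤ a q)) p

  sum≡0ʳ : ∀ {a b} → 0ℚ ≤ a → 0ℚ ≤ b → a + b ≡ 0ℚ → b ≡ 0ℚ
  sum≡0ʳ {a} {b} p q e = sum≡0ˡ q p (trans (ℚₚ.+-comm b a) e)

  -≡0 : ∀ {a b} → a - b ≡ 0ℚ → a ≡ b
  -≡0 {a} {b} e = ℚₚ.≤-antisym (0≤-⇒≤ (ℚₚ.≤-reflexive (trans (cong -_ (sym e)) (flip a b))))
    (0≤-⇒≤ (ℚₚ.≤-reflexive (sym e)))
    where
    flip : ∀ a b → - (a - b) ≡ b - a
    flip = RingSolver.solve-∀ ℚ-ring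

  product≡0 : ∀ {a b} → 0ℚ ≤ a → 0ℚ ≤ b → a * b ≡ 0ℚ → a ≡ 0ℚ ⊎ b ≡ 0ℚ
  product≡0 {a} {b} 0≤a 0≤b e with ℚₚ.<-cmp 0ℚ b
  ... | tri< 0<b _ _ = inj₁ (≡0-cancelʳ 0<b e)
  ... | tri≈ _ 0≡b _ = inj₂ (sym 0≡b)
  ... | tri> _ _ b<0 = contradiction (ℚₚ.<-≤-trans b<0 0≤b) (ℚₚ.<-irrefl refl)

  ι : ℕ → ℚ
  ι zero    = 0ℚ
  ι (suc n) = 1ℚ + ι n

  0<1+ : ∀ {x} → 0ℚ ≤ x → 0ℚ < 1ℚ + x
  0<1+ {x} 0≤x = subst (_< 1ℚ + x) (ℚₚ.+-identityˡ 0ℚ) (ℚₚ.+-mono-<-≤ (ℚₚ.positive⁻¹ 1ℚ) 0≤x)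

  0≤ι : ∀ n → 0ℚ ≤ ι n
  0≤ι zero    = ℚₚ.≤-refl
  0≤ι (suc n) = ℚₚ.<⇒≤ (0<1+ (0≤ι n))

  ι-mono-< : ∀ {m n} → m ℕ.< n → ι m < ι n
  ι-mono-< {zero}  {suc n} _         = 0<1+ (0≤ι n)
  ι-mono-< {suc m} {suc n} (s≤s m<n) = ℚₚ.+-monoʳ-< 1ℚ (ι-mono-< m<n)

  ι-mono-≤ : ∀ {m n} → m ℕ.≤ n → ι m ≤ ι n
  ι-mono-≤ {zero}  {n}     _         = 0≤ι n
  ι-mono-≤ {suc m} {suc n} (s≤s m≤n) = ℚₚ.+-monoʳ-≤ 1ℚ (ι-mono-≤ m≤n)

  ι-injective : ∀ {m n} → ι m ≡ ι n → m ≡ n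
  ι-injective {m} {n} e with ℕₚ.<-cmp m n
  ... | tri< m<n _ _ = contradiction (ι-mono-< m<n) (ℚₚ.<-irrefl e)
  ... | tri≈ _ m≡n _ = m≡n
  ... | tri> _ _ n<m = contradiction (ι-mono-< n<m) (ℚₚ.<-irrefl (sym e))

  square : ℚ → Point
  square x = x , x * x

  -- The chord is kept as its surplus `(x - P) * (M - x)` over the parabola, which is nonnegative
  -- and vanishes only at the two ends.
  record OnChord (P M : ℚ) (z : Point) : Set where
    constructor onChord
    field
      above  : 0ℚ ≤ proj₁ z - P
      below  : 0ℚ ≤ M - proj₁ z
      height : proj₂ z ≡ proj₁ z * proj₁ z + (proj₁ z - P) * (M - proj₁ z)

    height-0≤ : 0ℚ ≤ (proj₁ z - P) * (M - proj₁ z)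
    height-0≤ = 0≤* above below

  segment⇒chord : ∀ {P M z} → P < M → OnSegment (square M) (square P) z → OnChord P M z
  segment⇒chord {P} {M} P<M (l , 0≤l , l≤1 , refl , refl) = onChord
    (subst (0ℚ ≤_) (eq₁ P M l) (0≤* (≤⇒0≤- l≤1) 0≤M-P))
    (subst (0ℚ ≤_) (eq₂ P M l) (0≤* 0≤l 0≤M-P))
    (eq₃ P M l)
    where
    0≤M-P : 0ℚ ≤ M - P
    0≤M-P = ≤⇒0≤- (ℚₚ.<⇒≤ P<M)
    eq₁ : ∀ P M l → (1ℚ - l) * (M - P) ≡ M + l * (P - M) - P
    eq₁ = RingSolver.solve-∀ ℚ-ring
    eq₂ : ∀ P M l → l * (M - P) ≡ M - (M + l * (P - M))
    eq₂ = RingSolver.solve-∀ ℚ-ring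
    eq₃ : ∀ P M l → M * M + l * (P * P - M * M) ≡
          (M + l * (P - M)) * (M + l * (P - M)) + (M + l * (P - M) - P) * (M - (M + l * (P - M)))
    eq₃ = RingSolver.solve-∀ ℚ-ring

  chord-parabola : ∀ {P M z} → OnChord P M z → proj₂ z ≡ proj₁ z * proj₁ z →
                   proj₁ z ≡ P ⊎ proj₁ z ≡ M
  chord-parabola {P} {M} {X , Y} c e with
    product≡0 (OnChord.above c) (OnChord.below c) (cancel (X * X) _ (trans (sym (OnChord.height c)) e))
    where
    cancel : ∀ a b → a + b ≡ a → b ≡ 0ℚ
    cancel a b h = trans (add a b) (trans (cong (_- a) h) (ℚₚ.+-inverseʳ a))
      where
      add : ∀ a b → b ≡ a + b - a
      add = RingSolver.solve-∀ ℚ-ring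
  ... | inj₁ h = inj₁ (-≡0 h)
  ... | inj₂ h = inj₂ (sym (-≡0 h))

  chords-disjoint : ∀ {P M P′ M′ z} → M′ ≤ P → OnChord P M z → OnChord P′ M′ z → proj₁ z ≡ P × P ≡ M′
  chords-disjoint {P} {z = X , _} M′≤P c c′ =
    ℚₚ.≤-antisym (ℚₚ.≤-trans X≤M′ M′≤P) P≤X , ℚₚ.≤-antisym (ℚₚ.≤-trans P≤X X≤M′) M′≤P
    where
    P≤X = 0≤-⇒≤ (OnChord.above c)
    X≤M′ = 0≤-⇒≤ (OnChord.below c′)

  -- With a = X - P ≥ c = X - P′ and b = M - X > d = M′ - X, equal heights a b = c d
  -- rearrange to a (b - d) + (a - c) d = 0.
  chords-nested : ∀ {P M P′ M′ z} → P ≤ P′ → M′ < M → OnChord P M z → OnChord P′ M′ z →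
                  proj₁ z ≡ P × P ≡ P′
  chords-nested {P} {M} {P′} {M′} {X , Y} P≤P′ M′<M c c′ =
    X≡P , ℚₚ.≤-antisym P≤P′ (subst (P′ ≤_) X≡P (0≤-⇒≤ (OnChord.above c′)))
    where
    rearrange : ∀ X P M P′ M′ → (X - P) * (M - M′) + (P′ - P) * (M′ - X) ≡
                (X * X + (X - P) * (M - X)) - (X * X + (X - P′) * (M′ - X))
    rearrange = RingSolver.solve-∀ ℚ-ring
    X≡P : X ≡ P
    X≡P = -≡0 (≡0-cancelʳ (<⇒0<- M′<M) (sum≡0ˡ
      (0≤* (OnChord.above c) (≤⇒0≤- (ℚₚ.<⇒≤ M′<M)))
      (0≤* (≤⇒0≤- P≤P′) (OnChord.below c′))
      (trans (rearrange X P M P′ M′)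
        (trans (cong₂ _-_ (sym (OnChord.height c)) (sym (OnChord.height c′))) (ℚₚ.+-inverseʳ Y)))))

  module Drawing (K : ℚ) where

    ground : Point
    ground = 0ℚ , - K

    -- The parameter `s` is 0 at the ground and 1 on the parabola.
    record OnStar (M : ℚ) (z : Point) : Set where
      constructor onStar
      field
        s     : ℚ
        0≤s   : 0ℚ ≤ s
        s≤1   : 0ℚ ≤ 1ℚ - s
        x≡    : proj₁ z ≡ s * M
        y≡    : proj₂ z ≡ s * (M * M + K) - K

    segment⇒star : ∀ {M z} → OnSegment (square M) ground z → OnStar M z
    segment⇒star {M} (l , 0≤l , l≤1 , refl , refl) =
      onStar (1ℚ - l) (≤⇒0≤- l≤1) (subst (0ℚ ≤_) (eq₁ l) 0≤l) (eq₂ M l) (eq₃ M K l)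
      where
      eq₁ : ∀ l → l ≡ 1ℚ - (1ℚ - l)
      eq₁ = RingSolver.solve-∀ ℚ-ring
      eq₂ : ∀ M l → M + l * (0ℚ - M) ≡ (1ℚ - l) * M
      eq₂ = RingSolver.solve-∀ ℚ-ring
      eq₃ : ∀ M K l → M * M + l * (- K - M * M) ≡ (1ℚ - l) * (M * M + K) - K
      eq₃ = RingSolver.solve-∀ ℚ-ring

    module _ {M : ℚ} (MM<K : M * M < K) where
      -- The star edge runs below the parabola by `(1 - s) * (K - s * (M * M))`. At height `h` above
      -- it, depth and `h` add up to 0, so both vanish and `s` is 1.
      star-above : ∀ {z} → OnStar M z → ∀ {h} → 0ℚ ≤ h →
                   proj₂ z ≡ proj₁ z * proj₁ z + h → h ≡ 0ℚ × proj₁ z ≡ M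
      star-above {X , Y} (onStar s 0≤s s≤1 refl refl) {h} 0≤h e =
        sum≡0ˡ 0≤h 0≤d h+d≡0 , trans (cong (_* M) (sym 1≡s)) (ℚₚ.*-identityˡ M)
        where
        sMM<K : s * (M * M) < K
        sMM<K = ℚₚ.≤-<-trans (0≤-⇒≤ (subst (0ℚ ≤_) (eq s (M * M))
          (0≤* s≤1 (square-0≤ M)))) MM<K
          where
          eq : ∀ s a → (1ℚ - s) * a ≡ a - s * a
          eq = RingSolver.solve-∀ ℚ-ring
          square-0≤ : ∀ x → 0ℚ ≤ x * x
          square-0≤ x with ℚₚ.≤-total 0ℚ x
          ... | inj₁ 0≤x = 0≤* 0≤x 0≤x
          ... | inj₂ x≤0 = subst (0ℚ ≤_) (neg x) (0≤* (≤⇒0≤- x≤0) (≤⇒0≤- x≤0))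
            where
            neg : ∀ x → (0ℚ - x) * (0ℚ - x) ≡ x * x
            neg = RingSolver.solve-∀ ℚ-ring
        d : ℚ
        d = (1ℚ - s) * (K - s * (M * M))
        0≤d : 0ℚ ≤ d
        0≤d = 0≤* s≤1 (≤⇒0≤- (ℚₚ.<⇒≤ sMM<K))
        h+d≡0 : h + d ≡ 0ℚ
        h+d≡0 = trans (eq₁ (s * M * (s * M)) h d)
          (trans (cong (λ y → y + d - s * M * (s * M)) (sym e)) (eq₂ s M K))
          where
          eq₁ : ∀ a h d → h + d ≡ a + h + d - a
          eq₁ = RingSolver.solve-∀ ℚ-ring
          eq₂ : ∀ s M K → s * (M * M + K) - K + (1ℚ - s) * (K - s * (M * M)) - s * M * (s * M) ≡ 0ℚ
          eq₂ = RingSolver.solve-∀ ℚ-ring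
        1≡s : 1ℚ ≡ s
        1≡s = -≡0 (≡0-cancelʳ (<⇒0<- sMM<K) (sum≡0ʳ 0≤h 0≤d h+d≡0))

    -- Seen from the ground the edges have directions `(M , M * M + K)` and `(M′ , M′ * M′ + K)`.
    -- Their determinant is, up to sign, `(M′ - M) * (K - M * M′)` and so nonzero.
    stars-< : ∀ {M M′ z} → M < M′ → M * M′ < K → OnStar M z → OnStar M′ z → z ≡ ground
    stars-< {M} {M′} M<M′ MM′<K (onStar s _ _ refl refl) (onStar s′ _ _ x≡ y≡) =
      cong₂ _,_ (trans (cong (_* M) s≡0) (ℚₚ.*-zeroˡ M))
        (trans (cong (λ s → s * (M * M + K) - K) s≡0) (eq₂ (M * M + K) K))
      where
      eq₁ : ∀ s s′ M M′ K → s * (M′ - M) * (K - M * M′) ≡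
            M′ * ((s * (M * M + K) - K) - (s′ * (M′ * M′ + K) - K)) - (s * M - s′ * M′) * (M′ * M′ + K)
      eq₁ = RingSolver.solve-∀ ℚ-ring
      eq₂ : ∀ a K → 0ℚ * a - K ≡ - K
      eq₂ = RingSolver.solve-∀ ℚ-ring
      eq₃ : ∀ a b c d → a * (b - b) - (c - c) * d ≡ 0ℚ
      eq₃ = RingSolver.solve-∀ ℚ-ring
      s≡0 : s ≡ 0ℚ
      s≡0 = ≡0-cancelʳ (<⇒0<- M<M′) (≡0-cancelʳ (<⇒0<- MM′<K) (trans (eq₁ s s′ M M′ K)
        (trans (cong₂ (λ y x → M′ * (s * (M * M + K) - K - y) - (s * M - x) * (M′ * M′ + K)) (sym y≡) (sym x≡))
          (eq₃ M′ (s * (M * M + K) - K) (s * M) (M′ * M′ + K)))))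

  chord-at-lower : ∀ {P M z} → OnChord P M z → proj₁ z ≡ P → z ≡ square P
  chord-at-lower {P} {M} {X , Y} c refl = cong (X ,_) (trans (OnChord.height c)
    (trans (cong (λ d → X * X + d * (M - X)) (ℚₚ.+-inverseʳ X))
      (trans (cong (X * X +_) (ℚₚ.*-zeroˡ (M - X))) (ℚₚ.+-identityʳ (X * X)))))

  -- The vertex k ≥ 1 lies on the parabola y = x², where tree edges are chords above it; the
  -- vertex 0 lies so far below that the star edges reach the parabola only at their upper end.
  module Layout (n : ℕ) where

    κ : ℚ
    κ = ι (suc n)

    open Drawing (κ * κ)

    position : ℕ → Point
    position zero    = ground
    position (suc k) = square (ι (suc k))

    position-x : ∀ k → proj₁ (position k) ≡ ι k
    position-x zero    = refl
    position-x (suc k) = refl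

    position-injective : ∀ {k l} → position k ≡ position l → k ≡ l
    position-injective {k} {l} e =
      ι-injective (trans (sym (position-x k)) (trans (cong proj₁ e) (position-x l)))

    ι*ι<κκ : ∀ {k l} → k ℕ.< suc n → l ℕ.< suc n → ι k * ι l < κ * κ
    ι*ι<κκ {k} {l} k<n l<n = ℚₚ.≤-<-trans (≤-*-mono (ι k) (0≤ι k) (ι-mono-≤ (ℕₚ.<⇒≤ l<n)))
      (ℚₚ.*-monoˡ-<-pos κ {{ℚ.positive (0<1+ (0≤ι n))}} (ι-mono-< k<n))

    OnLink : Link → Point → Set
    OnLink (m , p) = OnSegment (position m) (position p)

    IsEnd : ℕ → Link → Set
    IsEnd w (m , p) = w ≡ m ⊎ w ≡ p

    link-chord : ∀ {m p z} → suc p ℕ.< m → OnLink (m , suc p) z → OnChord (ι (suc p)) (ι m) z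
    link-chord {suc m} p<m = segment⇒chord (ι-mono-< p<m)

    link-star : ∀ {m z} → 0 ℕ.< m → OnLink (m , 0) z → OnStar (ι m) z
    link-star {suc m} _ = segment⇒star

    square≡position : ∀ {m} → 0 ℕ.< m → square (ι m) ≡ position m
    square≡position {suc m} _ = refl

    vertex-off-link : ∀ {m p} w → Good (suc n) (m , p) → OnLink (m , p) (position w) → IsEnd w (m , p)
    vertex-off-link {m} {zero} zero    _           _ = inj₂ refl
    vertex-off-link {m} {zero} (suc w) (0<m , m<n) o =
      inj₁ (ι-injective (proj₂ (star-above (ι*ι<κκ m<n m<n) (link-star 0<m o) ℚₚ.≤-refl
        (sym (ℚₚ.+-identityʳ (ι (suc w) * ι (suc w)))))))
    vertex-off-link {m} {suc p} (suc w) (p<m , m<n) o =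
      [ inj₂ ∘ ι-injective , inj₁ ∘ ι-injective ]′ (chord-parabola (link-chord p<m o) refl)
    vertex-off-link {m} {suc p} zero    (p<m , m<n) o =
      contradiction (ℚₚ.<-≤-trans ground<0 (subst (0ℚ ≤_) (sym height) 0≤height)) (ℚₚ.<-irrefl refl)
      where
      c = link-chord p<m o
      0≤height = OnChord.height-0≤ c
      height : - (κ * κ) ≡ (0ℚ - ι (suc p)) * (ι m - 0ℚ)
      height = trans (OnChord.height c) (ℚₚ.+-identityˡ ((0ℚ - ι (suc p)) * (ι m - 0ℚ)))
      ground<0 : - (κ * κ) < 0ℚ
      ground<0 = ℚₚ.neg-antimono-< (0<* (0<1+ (0≤ι n)) (0<1+ (0≤ι n)))

    -- Star edges stay on or below the parabola and chords on or above it, so they can meet only on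
    -- the parabola.
    star-chord : ∀ {m m′ p′ z} → Good (suc n) (m , 0) → Good (suc n) (m′ , suc p′) →
                 OnLink (m , 0) z → OnLink (m′ , suc p′) z →
                 IsEnd m (m′ , suc p′) × z ≡ position m
    star-chord {m} {z = X , Y} (0<m , m<n) (p<m′ , _) o o′ =
      [ inj₂ ∘ ι-injective ∘ trans (sym X≡m) , inj₁ ∘ ι-injective ∘ trans (sym X≡m) ]′
        (chord-parabola c Y≡XX) ,
      trans (cong₂ _,_ X≡m (trans Y≡XX (cong₂ _*_ X≡m X≡m))) (square≡position 0<m)
      where
      c = link-chord p<m′ o′
      on-parabola = star-above (ι*ι<κκ m<n m<n) (link-star 0<m o) (OnChord.height-0≤ c) (OnChord.height c)
      X≡m = proj₂ on-parabola
      Y≡XX : Y ≡ X * X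
      Y≡XX = trans (OnChord.height c)
        (trans (cong (X * X +_) (proj₁ on-parabola)) (ℚₚ.+-identityʳ (X * X)))

    links-meet-at-ends : ∀ {e f z} → Good (suc n) e → Good (suc n) f → Compatible e f →
                         OnLink e z → OnLink f z → ∃ λ w → IsEnd w e × IsEnd w f × z ≡ position w
    links-meet-at-ends {m , zero} {m′ , zero} {z} (0<m , m<n) (0<m′ , m′<n) m≢m′ o o′ =
      0 , inj₂ refl , inj₂ refl , at-ground (ℕₚ.<-cmp m m′)
      where
      at-ground : Tri (m ℕ.< m′) (m ≡ m′) (m′ ℕ.< m) → z ≡ ground
      at-ground (tri< m<m′ _ _) =
        stars-< (ι-mono-< m<m′) (ι*ι<κκ m<n m′<n) (link-star 0<m o) (link-star 0<m′ o′)
      at-ground (tri≈ _ m≡m′ _) = contradiction m≡m′ m≢m′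
      at-ground (tri> _ _ m′<m) =
        stars-< (ι-mono-< m′<m) (ι*ι<κκ m′<n m<n) (link-star 0<m′ o′) (link-star 0<m o)
    links-meet-at-ends {m , zero} {m′ , suc p′} g g′ _ o o′ =
      let end , z≡ = star-chord g g′ o o′ in m , inj₁ refl , end , z≡
    links-meet-at-ends {m , suc p} {m′ , zero} g g′ _ o o′ =
      let end , z≡ = star-chord g′ g o′ o in m′ , end , inj₁ refl , z≡
    links-meet-at-ends {m , suc p} {m′ , suc p′} (p<m , _) (p′<m′ , _) (m′<m , inj₁ p≤p′) o o′ =
      let c = link-chord p<m o
          X≡P , P≡P′ = chords-nested (ι-mono-≤ p≤p′) (ι-mono-< m′<m) c (link-chord p′<m′ o′)
      in suc p , inj₂ refl , inj₂ (ι-injective P≡P′) , chord-at-lower c X≡P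
    links-meet-at-ends {m , suc p} {m′ , suc p′} (p<m , _) (p′<m′ , _) (m′<m , inj₂ m′≤p) o o′ =
      let c = link-chord p<m o
          X≡P , P≡M′ = chords-disjoint (ι-mono-≤ m′≤p) c (link-chord p′<m′ o′)
      in suc p , inj₂ refl , inj₁ (ι-injective P≡M′) , chord-at-lower c X≡P

    open Numbering n using (toℕ²)

    planar : ∀ {H : MGraph (suc n)} → All (Good (suc n) ∘ toℕ²) H →
             AllPairs (Compatible on toℕ²) H → Planar H
    planar {H} good compatible = position ∘ toℕ , record
      { injective  = Finₚ.toℕ-injective ∘ position-injective
      ; vertexOff  = λ w i ¬end o → ¬end ([ inj₁ ∘ Finₚ.toℕ-injective , inj₂ ∘ Finₚ.toℕ-injective ]′
                       (vertex-off-link (toℕ w) (good-at i) o))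
      ; noCrossing = λ i j i≢j x o o′ → meeting i j (
          [ (λ c → links-meet-at-ends (good-at i) (good-at j) c o o′)
          , (λ c → let w , a , b , e = links-meet-at-ends (good-at j) (good-at i) c o′ o in w , b , a , e) ]′
          (allPairs-lookup compatible i j i≢j)) }
      where
      good-at : ∀ i → Good (suc n) (toℕ² (lookup H i))
      good-at i = All.lookup good (∈-lookup i)

      endpoint : ∀ {v e} → IsEnd (toℕ v) (toℕ² e) → Endpoint v e
      endpoint = [ inj₁ ∘ Finₚ.toℕ-injective , inj₂ ∘ Finₚ.toℕ-injective ]′

      meeting : ∀ i j {z} →
        (∃ λ w → IsEnd w (toℕ² (lookup H i)) × IsEnd w (toℕ² (lookup H j)) × z ≡ position w) →
        ∃ λ v → Endpoint v (lookup H i) × Endpoint v (lookup H j) × z ≡ position (toℕ v)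
      meeting i j (_ , inj₁ refl , b , z≡) = _ , inj₁ refl , endpoint b , z≡
      meeting i j (_ , inj₂ refl , b , z≡) = _ , inj₂ refl , endpoint b , z≡

open import Data.Nat using (_+_; _*_; _∸_; _^_; _≤_; _<_)

-- Networks

fresh-isolated : ∀ {n F} → All (Within n) F → ∀ {y} → Conn F n y → n ≡ y
fresh-isolated w done      = refl
fresh-isolated w (fwd e _) = contradiction (proj₁ (All.lookup w e)) (ℕₚ.<-irrefl refl)
fresh-isolated w (bwd e _) = contradiction (proj₂ (All.lookup w e)) (ℕₚ.<-irrefl refl)

-- Collapsing the newest vertex `n` onto a neighbour `x` turns paths through `n` into paths among
-- the older vertices.
redirect : ℕ → ℕ → ℕ → ℕ
redirect n x v with v ℕ.≟ n
... | yes _ = x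
... | no  _ = v

redirect-self : ∀ n x → redirect n x n ≡ x
redirect-self n x with n ℕ.≟ n
... | yes _  = refl
... | no n≢n = contradiction refl n≢n

redirect-< : ∀ {n x v} → v < n → redirect n x v ≡ v
redirect-< {n} {x} {v} v<n with v ℕ.≟ n
... | yes refl = contradiction v<n (ℕₚ.<-irrefl refl)
... | no _     = refl

conn-redirect : ∀ {n x F F′} → (∀ {a b} → (a , b) ∈ F → Conn F′ (redirect n x a) (redirect n x b)) →
                ∀ {u v} → u < n → v < n → Conn F u v → Conn F′ u v
conn-redirect {n} {x} h u<n v<n c =
  subst₂ (Conn _) (redirect-< u<n) (redirect-< v<n) (conn-bind (redirect n x) h c)

redirect-within : ∀ {n x F F′} → All (Within n) F → (∀ {e} → e ∈ F → e ∈ F′) → ∀ {a b} →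
                  (a , b) ∈ F → Conn F′ (redirect n x a) (redirect n x b)
redirect-within {n} {x} {F} {F′} w F⊆F′ e with All.lookup w e
... | a<n , b<n = subst₂ (Conn F′) (sym (redirect-< a<n)) (sym (redirect-< b<n)) (edge (F⊆F′ e))

connected-suc : ∀ {n F x} → x < n → (∀ {u v} → u < n → v < n → Conn F u v) → Conn F n x →
                ∀ {u v} → u < suc n → v < suc n → Conn F u v
connected-suc x<n c nx u<1+n v<1+n with ℕₚ.m<1+n⇒m<n∨m≡n u<1+n | ℕₚ.m<1+n⇒m<n∨m≡n v<1+n
... | inj₁ u<n  | inj₁ v<n  = c u<n v<n
... | inj₁ u<n  | inj₂ refl = conn-trans (c u<n x<n) (conn-sym nx)
... | inj₂ refl | inj₁ v<n  = conn-trans nx (c x<n v<n)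
... | inj₂ refl | inj₂ refl = done

tree-pendant : ∀ {n x F} → x < n → All (Within n) F → Tree< (suc n) ((n , x) ∷ F) ⇔ Tree< n F
tree-pendant {n} {x} {F} x<n w = mk⇔
  (λ (c , _ , a) → (λ u<n v<n → conn-redirect collapse u<n v<n
     (c (ℕₚ.m<n⇒m<1+n u<n) (ℕₚ.m<n⇒m<1+n v<n))) , a)
  (λ (c , a) → connected-suc x<n (λ u<n v<n → conn-mono there (c u<n v<n)) (edge (here refl)) ,
     (λ nx → ℕₚ.<-irrefl (sym (fresh-isolated w nx)) x<n) , a)
  where
  collapse : ∀ {a b} → (a , b) ∈ (n , x) ∷ F → Conn F (redirect n x a) (redirect n x b)
  collapse (here refl) = subst₂ (Conn F) (sym (redirect-self n x)) (sym (redirect-< x<n)) done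
  collapse (there e)   = redirect-within w id e

-- Read from right to left, the new vertex `n` subdivides the edge `(x , y)`.
tree-series : ∀ {n x y F} → x < n → y < n → All (Within n) F →
              Tree< (suc n) ((n , x) ∷ (n , y) ∷ F) ⇔ Tree< n ((x , y) ∷ F)
tree-series {n} {x} {y} {F} x<n y<n w = mk⇔
  (λ (c , nx , ny , a) →
     (λ u<n v<n → conn-redirect collapse u<n v<n (c (ℕₚ.m<n⇒m<1+n u<n) (ℕₚ.m<n⇒m<1+n v<n))) ,
     (λ xy → nx (fwd (here refl) (conn-sym (conn-mono there xy)))) , a)
  (λ (c , xy , a) →
     connected-suc x<n (λ u<n v<n → conn-bind id expand (c u<n v<n)) (edge (here refl)) ,
     (λ nx → [ (λ c′ → isolated x<n c′)
             , [ (λ (_ , yx) → xy (conn-sym yx)) , (λ (ny , _) → isolated y<n ny) ]′ ]′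
             (conn-exchange nx)) ,
     isolated y<n , a)
  where
  isolated : ∀ {z} → z < n → ¬ Conn F n z
  isolated z<n nz = ℕₚ.<-irrefl (sym (fresh-isolated w nz)) z<n

  collapse : ∀ {a b} → (a , b) ∈ (n , x) ∷ (n , y) ∷ F →
             Conn ((x , y) ∷ F) (redirect n x a) (redirect n x b)
  collapse (here refl) =
    subst₂ (Conn _) (sym (redirect-self n x)) (sym (redirect-< x<n)) done
  collapse (there (here refl)) =
    subst₂ (Conn _) (sym (redirect-self n x)) (sym (redirect-< y<n)) (edge (here refl))
  collapse (there (there e)) = redirect-within w there e

  expand : ∀ {a b} → (a , b) ∈ (x , y) ∷ F → Conn ((n , x) ∷ (n , y) ∷ F) a b
  expand (here refl) = bwd (here refl) (fwd (there (here refl)) done)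
  expand (there e)   = edge (there (there e))

tree-isolated : ∀ {n F} → All (Within (suc n)) F → ¬ Tree< (suc (suc n)) F
tree-isolated {n} w (c , _) with fresh-isolated w (c {suc n} {0} (ℕₚ.n<1+n _) z<s)
... | ()

-- The number of edge sets S ⊆ G for which L ++ S is a spanning tree of {0, …, n-1}:
-- the edges in L are forced, which for the count is the same as contracting them.
Trees : ℕ → List Link → List Link → ℕ → Set
Trees n L G = Count (λ S → Tree< n (L ++ select G S))

-- Deletion and contraction: trees through `e` have it forced, the others never see it.
trees-∷ : ∀ {n} L {e G a b} → Trees n (e ∷ L) G a → Trees n L G b → Trees n L (e ∷ G) (a + b)
trees-∷ L {e} {G} used unused = count-∷
  (count-⇔ (λ S → mk⇔ (tree-↭ (↭-sym (Permₚ.shift e L (select G S))))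
                       (tree-↭ (Permₚ.shift e L (select G S)))) used)
  unused

module _ {n c L G} (c<n : c < suc n) (wL : All (Within (suc n)) L) (wG : All (Within (suc n)) G) where
  private
    within : ∀ S → All (Within (suc n)) (L ++ select G S)
    within S = Allₚ.++⁺ wL (select-All wG S)

  trees-pendant : ∀ {k} → Trees (suc n) L G k → Trees (suc (suc n)) ((suc n , c) ∷ L) G k
  trees-pendant = count-⇔ λ S →
    mk⇔ (from (tree-pendant c<n (within S))) (to (tree-pendant c<n (within S)))

  trees-grow : ∀ {k} → Trees (suc n) L G k → Trees (suc (suc n)) L ((suc n , c) ∷ G) k
  trees-grow {k} t = subst (Trees _ L _) (ℕₚ.+-identityʳ k)
    (trees-∷ L (trees-pendant t) (count-none (λ S → tree-isolated (within S))))

-- The new vertex is tied to 0. If its link to `c` is used, the two links in series tie `c` to 0,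
-- which gives `x`; otherwise the new vertex is a leaf at 0, which gives `y`.
trees-grow-link : ∀ {n c L G x y} → c < suc n → All (Within (suc n)) L → All (Within (suc n)) G →
                  Trees (suc n) ((c , 0) ∷ L) G x → Trees (suc n) L G y →
                  Trees (suc (suc n)) ((suc n , 0) ∷ L) ((suc n , c) ∷ G) (x + y)
trees-grow-link {n} {c} {L} {G} c<n wL wG tx ty = trees-∷ ((suc n , 0) ∷ L)
  (count-⇔ (λ S → let s = tree-series c<n z<s (Allₚ.++⁺ wL (select-All wG S)) in
                  mk⇔ (from s) (to s)) tx)
  (trees-pendant z<s wL wG ty)

-- A network on the vertices {0, …, n} with terminals 0 and suc a.  T and F count the spanning
-- trees before and after identification of the terminals, so the resistance is F/T.
record Net (n F T : ℕ) : Set where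
  field
    a          : ℕ
    G          : List Link
    a<n        : a < n
    good       : All (Good (suc n)) G
    compatible : AllPairs Compatible ((suc a , 0) ∷ G)
    visible    : All (Visible (suc a)) G
    trees      : Trees (suc n) [] G T
    forests    : Trees (suc n) ((suc a , 0) ∷ []) G F

net-start : Net 1 1 0
net-start = record
  { a = 0 ; G = [] ; a<n = z<s ; good = [] ; compatible = [] ∷ [] ; visible = []
  ; trees = count-none λ { [] → tree-isolated [] }
  ; forests = count-[] (from (tree-pendant z<s []) ((λ { z<s z<s → done }) , tt)) }

net-series : ∀ {n F T} → Net n F T → Net (suc n) (F + T) T
net-series {n} {F} {T} N = record
  { a = n ; G = (suc n , suc a) ∷ G ; a<n = ℕₚ.n<1+n n
  ; good = (s≤s a<n , ℕₚ.n<1+n _) ∷ All.map good-suc good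
  ; compatible = (tt ∷ All.map compatible-star good) ∷ All.zipWith (uncurry compatible-tree) (good , visible)
      ∷ compatible-G
  ; visible = inj₂ ℕₚ.≤-refl ∷ All.map visible-top good
  ; trees = trees-grow (s≤s a<n) [] within trees
  ; forests = trees-grow-link (s≤s a<n) [] within forests trees }
  where
  open Net N
  within : All (Within (suc n)) G
  within = All.map good⇒within good
  compatible-G : AllPairs Compatible G
  compatible-G with compatible
  ... | _ ∷ ps = ps

-- A network with an unfinished path of j edges leading from the terminal suc a to suc c.
record Leg (n F T j : ℕ) : Set where
  field
    a c        : ℕ
    G          : List Link
    a≤c        : a ≤ c
    c<n        : c < n
    good       : All (Good (suc n)) G
    star       : All (Compatible (suc a , 0)) G
    compatible : AllPairs Compatible G
    visible    : All (Visible (suc a)) G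
    tip        : All (Visible (suc c)) G
    trees      : Trees (suc n) [] G T
    forests    : Trees (suc n) ((suc a , 0) ∷ []) G F
    trees-tip  : Trees (suc n) ((suc c , 0) ∷ []) G (j * T + F)
    forests-tip : Trees (suc n) ((suc c , 0) ∷ (suc a , 0) ∷ []) G (j * F)

  within : All (Within (suc n)) G
  within = All.map good⇒within good

  compatible-new : All (Compatible (suc n , suc c)) G
  compatible-new = All.zipWith (uncurry compatible-tree) (good , tip)

  within-a : All (Within (suc n)) ((suc a , 0) ∷ [])
  within-a = (s≤s (ℕₚ.≤-<-trans a≤c c<n) , z<s) ∷ []

leg-start : ∀ {n F T} → Net n F T → Leg n F T 0
leg-start {n} N with Net.compatible N
... | s ∷ ps = record
  { a = a ; c = a ; G = G ; a≤c = ℕₚ.≤-refl ; c<n = a<n ; good = good ; star = s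
  ; compatible = ps ; visible = visible ; tip = visible ; trees = trees ; forests = forests
  ; trees-tip = forests
  ; forests-tip = count-none λ S (_ , n , _) → n (edge (here refl)) }
  where open Net N

-- Tying the tip to 0 makes the path a branch between the terminals: a tree omits one of its `j`
-- edges, with `T` ways each, or none, with `F` ways. If `suc a` is tied to 0 as well, exactly one
-- edge must be omitted, whence `j * F`.
leg-grow : ∀ {n F T j} → Leg n F T j → Leg (suc n) F T (suc j)
leg-grow {n} {F} {T} {j} ℓ = record
  { a = a ; c = n ; G = (suc n , suc c) ∷ G
  ; a≤c = ℕₚ.≤-trans a≤c (ℕₚ.<⇒≤ c<n) ; c<n = ℕₚ.n<1+n n
  ; good = (s≤s c<n , ℕₚ.n<1+n _) ∷ All.map good-suc good
  ; star = tt ∷ star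
  ; compatible = compatible-new ∷ compatible
  ; visible = inj₁ (s≤s a≤c) ∷ visible
  ; tip = inj₂ ℕₚ.≤-refl ∷ All.map visible-top good
  ; trees = trees-grow (s≤s c<n) [] within trees
  ; forests = trees-grow (s≤s c<n) within-a within forests
  ; trees-tip = subst (Trees _ _ _) (tip-count j T F) (trees-grow-link (s≤s c<n) [] within trees-tip trees)
  ; forests-tip = subst (Trees _ _ _) (ℕₚ.+-comm (j * F) F)
      (trees-grow-link (s≤s c<n) within-a within forests-tip forests) }
  where
  open Leg ℓ
  tip-count : ∀ j T F → j * T + F + T ≡ suc j * T + F
  tip-count = solve-∀

-- The last two edges enter together, so the path has at least two edges and the place of `e`
-- between `suc a` and 0 stays free.
leg-close : ∀ {n F T j} → Leg n F T j → Net (suc n) (suc (suc j) * F) (suc (suc j) * T + F)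
leg-close {n} {F} {T} {j} ℓ = record
  { a = a ; G = (suc n , 0) ∷ (suc n , suc c) ∷ G
  ; a<n = ℕₚ.m<n⇒m<1+n a<n
  ; good = (z<s , ℕₚ.n<1+n _) ∷ (s≤s c<n , ℕₚ.n<1+n _) ∷ All.map good-suc good
  ; compatible = (a≢n ∷ tt ∷ star) ∷ (tt ∷ All.map compatible-star good) ∷ compatible-new ∷ compatible
  ; visible = tt ∷ inj₁ (s≤s a≤c) ∷ visible
  ; trees = subst (Trees _ _ _) (close-trees j T F)
      (trees-∷ [] (trees-grow-link (s≤s c<n) [] within trees-tip trees)
                  (trees-grow (s≤s c<n) [] within trees))
  ; forests = subst (Trees _ _ _) (close-forests j F)
      (trees-∷ _ (trees-grow-link (s≤s c<n) within-a within forests-tip forests)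
                 (trees-grow (s≤s c<n) within-a within forests)) }
  where
  open Leg ℓ
  a<n : a < n
  a<n = ℕₚ.≤-<-trans a≤c c<n
  a≢n : suc a ≢ suc n
  a≢n e = ℕₚ.<-irrefl (ℕₚ.suc-injective e) a<n
  close-trees : ∀ j T F → j * T + F + T + T ≡ suc (suc j) * T + F
  close-trees = solve-∀
  close-forests : ∀ j F → j * F + F + F ≡ suc (suc j) * F
  close-forests = solve-∀

leg-extend : ∀ {n F T} → Net n F T → ∀ j → Leg (j + n) F T j
leg-extend N zero    = leg-start N
leg-extend N (suc j) = leg-grow (leg-extend N j)

net-shunt : ∀ {n F T} → Net n F T → ∀ j → Net (suc (j + n)) (suc (suc j) * F) (suc (suc j) * T + F)
net-shunt N j = leg-close (leg-extend N j)

-- From networks to graphs with a marked edge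

module _ {n : ℕ} where
  open Numbering n

  not-loops : ∀ {u v H} → All (Good (suc n) ∘ toℕ²) ((u , v) ∷ H) →
              AllPairs (Compatible on toℕ²) ((u , v) ∷ H) →
              All (λ e → proj₁ e ≢ proj₂ e × ¬ SameEnds e (u , v)) H
  not-loops (g ∷ gs) (c ∷ _) = All.zipWith
    (λ (g′ , c′) → good-loopless g′ , compatible-distinct g g′ c′ ∘ sameEnds-sym) (gs , c)

  realise-links : ∀ {a b} (e : Link) G → All (Good (suc n)) (e ∷ G) → AllPairs Compatible (e ∷ G) →
                  Trees (suc n) [] (e ∷ G) a → Trees (suc n) (e ∷ []) G b →
                  Σ (MGraph (suc n)) λ H → Σ (Simple H) λ s → Planar H × Σ (Fin (length H)) λ i →
                  HasTau H a × HasTau (contract H i (Simple.loopless s i)) b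
  realise-links e G good compatible t f with number (All.map good⇒within good)
  ... | (u , v) ∷ H , refl =
    (u , v) ∷ H , s , Plane.Layout.planar n good′ compatible′ , zero ,
    hasTau ((u , v) ∷ H) (count-map⁻ toℕ² (Tree< (suc n)) (Tree (λ _ → ⊤)) tree-toℕ ((u , v) ∷ H) t) ,
    Contraction.hasTau-contract u v (Simple.loopless s zero) (not-loops good′ compatible′)
      (count-map⁻ toℕ² (λ E → Tree< (suc n) (toℕ² (u , v) ∷ E)) (λ E → Tree (λ _ → ⊤) ((u , v) ∷ E))
        (λ E → tree-toℕ ((u , v) ∷ E)) H f)
    where
    good′ = Allₚ.map⁻ good
    compatible′ = AllPairsₚ.map⁻ compatible
    s = simple good′ compatible′

realise : ∀ {n F T} → Net n F T →
          Σ (MGraph (suc n)) λ H → Σ (Simple H) λ s → Planar H × Σ (Fin (length H)) λ e →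
          HasTau H (F + T) × HasTau (contract H e (Simple.loopless s e)) F
realise N = realise-links (suc a , 0) G ((z<s , s≤s a<n) ∷ good) compatible
  (trees-∷ [] forests trees) forests
  where open Net N

-- Ladders

-- The cost k bounds the number of vertices minus one; q = 0 stands for an open circuit.
record Realisable (p q k : ℕ) : Set where
  constructor realisable
  field
    {size F T} : ℕ
    net        : Net size F T
    size≤k     : size ≤ k
    0<F        : 0 < F
    ratio      : F * q ≡ T * p

weaken : ∀ {p q k k′} → k ≤ k′ → Realisable p q k → Realisable p q k′
weaken k≤k′ (realisable N size≤k 0<F e) = realisable N (ℕₚ.≤-trans size≤k k≤k′) 0<F e

open-circuit : Realisable 1 0 1
open-circuit = realisable net-start ℕₚ.≤-refl z<s refl

*-exchange : ∀ a b c → a * (b * c) ≡ b * (a * c)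
*-exchange = solve-∀

multiply : ∀ κ {p q k} → Realisable p q k → Realisable (κ * p) (κ * q) k
multiply κ {p} {q} (realisable {F = F} {T} N size≤k 0<F e) = realisable N size≤k 0<F
  (trans (*-exchange F κ q) (trans (cong (κ *_) e) (sym (*-exchange T κ p))))

-- The ladder identities hold only up to a common factor of numerator and denominator, which is
-- cancelled here.
reduce : ∀ κ {p q p′ q′ k} → p′ ≡ suc κ * p → q′ ≡ suc κ * q → Realisable p′ q′ k → Realisable p q k
reduce κ {p} {q} refl refl (realisable {F = F} {T} N size≤k 0<F e) = realisable N size≤k 0<F
  (ℕₚ.*-cancelˡ-≡ _ _ (suc κ) (trans (*-exchange (suc κ) F q) (trans e (sym (*-exchange (suc κ) T p)))))

recast : ∀ {p q p′ q′ k} → p ≡ p′ → q ≡ q′ → Realisable p q k → Realisable p′ q′ k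
recast refl refl r = r

series : ∀ {p q k} → Realisable p q k → Realisable (p + q) q (suc k)
series {p} {q} (realisable {F = F} {T} N size≤k 0<F e) =
  realisable (net-series N) (s≤s size≤k) (ℕₚ.<-≤-trans 0<F (ℕₚ.m≤m+n F T))
    (trans (ℕₚ.*-distribʳ-+ q F T) (trans (cong (_+ T * q) e) (sym (ℕₚ.*-distribˡ-+ T p q))))

shunt : ∀ j {p q k} → Realisable p q k →
        Realisable ((2 + j) * p) ((2 + j) * q + p) (suc j + k)
shunt j {p} {q} (realisable {F = F} {T} N size≤k 0<F e) =
  realisable (net-shunt N j) (s≤s (ℕₚ.+-monoʳ-≤ j size≤k)) (ℕₚ.<-≤-trans 0<F (ℕₚ.m≤m+n F _))
    (trans (eq₁ (2 + j) F p q)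
      (trans (cong (λ x → (2 + j) * ((2 + j) * x + F * p)) e) (eq₂ (2 + j) F T p)))
  where
  eq₁ : ∀ ℓ F p q → ℓ * F * (ℓ * q + p) ≡ ℓ * (ℓ * (F * q) + F * p)
  eq₁ = solve-∀
  eq₂ : ∀ ℓ F T p → ℓ * (ℓ * (T * p) + F * p) ≡ (ℓ * T + F) * (ℓ * p)
  eq₂ = solve-∀

series^ : ∀ s {p q k} → Realisable p q k → Realisable (p + s * q) q (s + k)
series^ zero    {p} r = recast (sym (ℕₚ.+-identityʳ p)) refl r
series^ (suc s) {p} {q} r =
  recast (eq p q s) refl (series (series^ s r))
  where
  eq : ∀ p q s → p + s * q + q ≡ p + suc s * q
  eq = solve-∀

shunt^ : ∀ j m {p q k} → Realisable p q k →
         Realisable ((2 + j) * p) ((2 + j) * q + m * p) (m * suc j + k)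
shunt^ j zero    {p} {q} r =
  recast (eq₁ j p) (eq₂ j q p) (multiply (2 + j) r)
  where
  eq₁ : ∀ j p → (2 + j) * p ≡ (2 + j) * p
  eq₁ = solve-∀
  eq₂ : ∀ j q p → (2 + j) * q ≡ (2 + j) * q + 0 * p
  eq₂ = solve-∀
shunt^ j (suc m) {p} {q} {k} r = weaken (ℕₚ.≤-reflexive (sym (ℕₚ.+-assoc (suc j) (m * suc j) k)))
  (reduce (suc j) (refl {x = (2 + j) * ((2 + j) * p)}) (eq j m p q) (shunt j (shunt^ j m r)))
  where
  eq : ∀ j m p q → (2 + j) * ((2 + j) * q + m * p) + (2 + j) * p ≡ (2 + j) * ((2 + j) * q + suc m * p)
  eq = solve-∀

-- Both families act on a resistance x = p/q as x ↦ 2 ∥ (N + (4 ∥ x)), where N = 2h in the first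
-- and N = -(8 + 2m) in the second family.  Nesting one ladder section on either side turns
-- N into 4N + s, so that |N| grows exponentially with the number of sections.
record Ladder⁺ (h c : ℕ) : Set where
  constructor ladder
  field
    load : ∀ {p q k} → Realisable p q k →
      Realisable (2 * h * (p + 4 * q) + 4 * p) (h * (p + 4 * q) + 3 * p + 4 * q) (c + k)

-- Numerator and denominator are both negated; thanks to the offset 8 in N all coefficients are then
-- nonnegative, and ℕ suffices.
record Ladder⁻ (m c : ℕ) : Set where
  constructor ladder
  field
    load : ∀ {p q k} → Realisable p q k →
      Realisable (2 * m * (p + 4 * q) + 4 * p + 32 * q) (m * (p + 4 * q) + p + 12 * q) (c + k)

weaken⁺ : ∀ {h c c′} → c ≤ c′ → Ladder⁺ h c → Ladder⁺ h c′
weaken⁺ c≤c′ (ladder G) = ladder λ {_} {_} {k} → weaken (ℕₚ.+-monoˡ-≤ k c≤c′) ∘ G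

weaken⁻ : ∀ {m c c′} → c ≤ c′ → Ladder⁻ m c → Ladder⁻ m c′
weaken⁻ c≤c′ (ladder G) = ladder λ {_} {_} {k} → weaken (ℕₚ.+-monoˡ-≤ k c≤c′) ∘ G

-- Up to a scalar this is both the left outer factor for e = 4 and the right outer factor for d = 4.
-- The left factor for e = 2 is `section₀`, the right factor for d = 8 is `section₂`.
section₁ : ∀ {p q k} → Realisable p q k → Realisable (4 * p + 8 * q) (p + 6 * q) (5 + k)
section₁ {p} {q} = recast (eq₁ p q) (eq₂ p q) ∘ shunt 2 ∘ series^ 2
  where
  eq₁ : ∀ p q → 4 * (p + 2 * q) ≡ 4 * p + 8 * q
  eq₁ = solve-∀
  eq₂ : ∀ p q → 4 * q + (p + 2 * q) ≡ p + 6 * q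
  eq₂ = solve-∀

section₂ : ∀ {p q k} → Realisable p q k → Realisable (12 * p + 32 * q) (p + 8 * q) (11 + k)
section₂ {p} {q} = recast (eq₁ p q) (eq₂ p q) ∘ series^ 4 ∘ shunt 6
  where
  eq₁ : ∀ p q → 8 * p + 4 * (8 * q + p) ≡ 12 * p + 32 * q
  eq₁ = solve-∀
  eq₂ : ∀ p q → 8 * q + p ≡ p + 8 * q
  eq₂ = solve-∀

-- Two new vertices suffice; the bound is raised to that of `section₁`, so that both left factors
-- share the same cost lemmas.
section₀ : ∀ {p q k} → Realisable p q k → Realisable (3 * p + 2 * q) (p + 2 * q) (5 + k)
section₀ {p} {q} {k} = weaken (ℕₚ.m≤n+m (2 + k) 3) ∘ recast (eq₁ p q) (eq₂ p q) ∘ series ∘ shunt 0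
  where
  eq₁ : ∀ p q → 2 * p + (2 * q + p) ≡ 3 * p + 2 * q
  eq₁ = solve-∀
  eq₂ : ∀ p q → 2 * q + p ≡ p + 2 * q
  eq₂ = solve-∀

section-cost₁ : ∀ c {p q k} → Realisable p q (5 + (c + (5 + k))) → Realisable p q (16 + c + k)
section-cost₁ c {k = k} = weaken (ℕₚ.≤-trans (ℕₚ.≤-reflexive (eq c k)) (ℕₚ.m≤n+m (10 + c + k) 6))
  where
  eq : ∀ c k → 5 + (c + (5 + k)) ≡ 10 + c + k
  eq = solve-∀

section-cost₂ : ∀ c {p q k} → Realisable p q (5 + (c + (11 + k))) → Realisable p q (16 + c + k)
section-cost₂ c {k = k} = weaken (ℕₚ.≤-reflexive (eq c k))
  where
  eq : ∀ c k → 5 + (c + (11 + k)) ≡ 16 + c + k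
  eq = solve-∀

module _ {h c : ℕ} (G : Ladder⁺ h c) where

  -- With N = 2h the step to 4N + d + e adds (d + e)/2, which is 3, 4, 5 or 6: four consecutive
  -- values, one for each residue modulo 4.
  ladder⁺-3 : Ladder⁺ (3 + h * 4) (16 + c)
  ladder⁺-3 = ladder λ {p} {q} →
    section-cost₁ c ∘ reduce 7 (eq₁ h p q) (eq₂ h p q) ∘ section₀ ∘ Ladder⁺.load G ∘ section₁
    where
    eq₁ : ∀ h p q → let p₁ = 4 * p + 8 * q; q₁ = p + 6 * q in
          3 * (2 * h * (p₁ + 4 * q₁) + 4 * p₁) + 2 * (h * (p₁ + 4 * q₁) + 3 * p₁ + 4 * q₁) ≡
          8 * (2 * (3 + h * 4) * (p + 4 * q) + 4 * p)
    eq₁ = solve-∀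
    eq₂ : ∀ h p q → let p₁ = 4 * p + 8 * q; q₁ = p + 6 * q in
          2 * h * (p₁ + 4 * q₁) + 4 * p₁ + 2 * (h * (p₁ + 4 * q₁) + 3 * p₁ + 4 * q₁) ≡
          8 * ((3 + h * 4) * (p + 4 * q) + 3 * p + 4 * q)
    eq₂ = solve-∀

  ladder⁺-4 : Ladder⁺ (4 + h * 4) (16 + c)
  ladder⁺-4 = ladder λ {p} {q} →
    section-cost₁ c ∘ reduce 15 (eq₁ h p q) (eq₂ h p q) ∘ section₁ ∘ Ladder⁺.load G ∘ section₁
    where
    eq₁ : ∀ h p q → let p₁ = 4 * p + 8 * q; q₁ = p + 6 * q in
          4 * (2 * h * (p₁ + 4 * q₁) + 4 * p₁) + 8 * (h * (p₁ + 4 * q₁) + 3 * p₁ + 4 * q₁) ≡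
          16 * (2 * (4 + h * 4) * (p + 4 * q) + 4 * p)
    eq₁ = solve-∀
    eq₂ : ∀ h p q → let p₁ = 4 * p + 8 * q; q₁ = p + 6 * q in
          2 * h * (p₁ + 4 * q₁) + 4 * p₁ + 6 * (h * (p₁ + 4 * q₁) + 3 * p₁ + 4 * q₁) ≡
          16 * ((4 + h * 4) * (p + 4 * q) + 3 * p + 4 * q)
    eq₂ = solve-∀

  ladder⁺-5 : Ladder⁺ (5 + h * 4) (16 + c)
  ladder⁺-5 = ladder λ {p} {q} →
    section-cost₂ c ∘ reduce 15 (eq₁ h p q) (eq₂ h p q) ∘ section₀ ∘ Ladder⁺.load G ∘ section₂
    where
    eq₁ : ∀ h p q → let p₁ = 12 * p + 32 * q; q₁ = p + 8 * q in
          3 * (2 * h * (p₁ + 4 * q₁) + 4 * p₁) + 2 * (h * (p₁ + 4 * q₁) + 3 * p₁ + 4 * q₁) ≡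
          16 * (2 * (5 + h * 4) * (p + 4 * q) + 4 * p)
    eq₁ = solve-∀
    eq₂ : ∀ h p q → let p₁ = 12 * p + 32 * q; q₁ = p + 8 * q in
          2 * h * (p₁ + 4 * q₁) + 4 * p₁ + 2 * (h * (p₁ + 4 * q₁) + 3 * p₁ + 4 * q₁) ≡
          16 * ((5 + h * 4) * (p + 4 * q) + 3 * p + 4 * q)
    eq₂ = solve-∀

  ladder⁺-6 : Ladder⁺ (6 + h * 4) (16 + c)
  ladder⁺-6 = ladder λ {p} {q} →
    section-cost₂ c ∘ reduce 31 (eq₁ h p q) (eq₂ h p q) ∘ section₁ ∘ Ladder⁺.load G ∘ section₂
    where
    eq₁ : ∀ h p q → let p₁ = 12 * p + 32 * q; q₁ = p + 8 * q in
          4 * (2 * h * (p₁ + 4 * q₁) + 4 * p₁) + 8 * (h * (p₁ + 4 * q₁) + 3 * p₁ + 4 * q₁) ≡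
          32 * (2 * (6 + h * 4) * (p + 4 * q) + 4 * p)
    eq₁ = solve-∀
    eq₂ : ∀ h p q → let p₁ = 12 * p + 32 * q; q₁ = p + 8 * q in
          2 * h * (p₁ + 4 * q₁) + 4 * p₁ + 6 * (h * (p₁ + 4 * q₁) + 3 * p₁ + 4 * q₁) ≡
          32 * ((6 + h * 4) * (p + 4 * q) + 3 * p + 4 * q)
    eq₂ = solve-∀

module _ {h c : ℕ} (G : Ladder⁻ h c) where

  -- With N = -(8 + 2h) the step to 4N + s turns h into 4h + 12 - s/2, so the same sections appear
  -- with the shifts in reverse order.
  ladder⁻-9 : Ladder⁻ (9 + h * 4) (16 + c)
  ladder⁻-9 = ladder λ {p} {q} →
    section-cost₁ c ∘ reduce 7 (eq₁ h p q) (eq₂ h p q) ∘ section₀ ∘ Ladder⁻.load G ∘ section₁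
    where
    eq₁ : ∀ h p q → let p₁ = 4 * p + 8 * q; q₁ = p + 6 * q in
          3 * (2 * h * (p₁ + 4 * q₁) + 4 * p₁ + 32 * q₁) + 2 * (h * (p₁ + 4 * q₁) + p₁ + 12 * q₁) ≡
          8 * (2 * (9 + h * 4) * (p + 4 * q) + 4 * p + 32 * q)
    eq₁ = solve-∀
    eq₂ : ∀ h p q → let p₁ = 4 * p + 8 * q; q₁ = p + 6 * q in
          2 * h * (p₁ + 4 * q₁) + 4 * p₁ + 32 * q₁ + 2 * (h * (p₁ + 4 * q₁) + p₁ + 12 * q₁) ≡
          8 * ((9 + h * 4) * (p + 4 * q) + p + 12 * q)
    eq₂ = solve-∀

  ladder⁻-8 : Ladder⁻ (8 + h * 4) (16 + c)
  ladder⁻-8 = ladder λ {p} {q} →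
    section-cost₁ c ∘ reduce 15 (eq₁ h p q) (eq₂ h p q) ∘ section₁ ∘ Ladder⁻.load G ∘ section₁
    where
    eq₁ : ∀ h p q → let p₁ = 4 * p + 8 * q; q₁ = p + 6 * q in
          4 * (2 * h * (p₁ + 4 * q₁) + 4 * p₁ + 32 * q₁) + 8 * (h * (p₁ + 4 * q₁) + p₁ + 12 * q₁) ≡
          16 * (2 * (8 + h * 4) * (p + 4 * q) + 4 * p + 32 * q)
    eq₁ = solve-∀
    eq₂ : ∀ h p q → let p₁ = 4 * p + 8 * q; q₁ = p + 6 * q in
          2 * h * (p₁ + 4 * q₁) + 4 * p₁ + 32 * q₁ + 6 * (h * (p₁ + 4 * q₁) + p₁ + 12 * q₁) ≡
          16 * ((8 + h * 4) * (p + 4 * q) + p + 12 * q)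
    eq₂ = solve-∀

  ladder⁻-7 : Ladder⁻ (7 + h * 4) (16 + c)
  ladder⁻-7 = ladder λ {p} {q} →
    section-cost₂ c ∘ reduce 15 (eq₁ h p q) (eq₂ h p q) ∘ section₀ ∘ Ladder⁻.load G ∘ section₂
    where
    eq₁ : ∀ h p q → let p₁ = 12 * p + 32 * q; q₁ = p + 8 * q in
          3 * (2 * h * (p₁ + 4 * q₁) + 4 * p₁ + 32 * q₁) + 2 * (h * (p₁ + 4 * q₁) + p₁ + 12 * q₁) ≡
          16 * (2 * (7 + h * 4) * (p + 4 * q) + 4 * p + 32 * q)
    eq₁ = solve-∀
    eq₂ : ∀ h p q → let p₁ = 12 * p + 32 * q; q₁ = p + 8 * q in
          2 * h * (p₁ + 4 * q₁) + 4 * p₁ + 32 * q₁ + 2 * (h * (p₁ + 4 * q₁) + p₁ + 12 * q₁) ≡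
          16 * ((7 + h * 4) * (p + 4 * q) + p + 12 * q)
    eq₂ = solve-∀

  ladder⁻-6 : Ladder⁻ (6 + h * 4) (16 + c)
  ladder⁻-6 = ladder λ {p} {q} →
    section-cost₂ c ∘ reduce 31 (eq₁ h p q) (eq₂ h p q) ∘ section₁ ∘ Ladder⁻.load G ∘ section₂
    where
    eq₁ : ∀ h p q → let p₁ = 12 * p + 32 * q; q₁ = p + 8 * q in
          4 * (2 * h * (p₁ + 4 * q₁) + 4 * p₁ + 32 * q₁) + 8 * (h * (p₁ + 4 * q₁) + p₁ + 12 * q₁) ≡
          32 * (2 * (6 + h * 4) * (p + 4 * q) + 4 * p + 32 * q)
    eq₁ = solve-∀
    eq₂ : ∀ h p q → let p₁ = 12 * p + 32 * q; q₁ = p + 8 * q in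
          2 * h * (p₁ + 4 * q₁) + 4 * p₁ + 32 * q₁ + 6 * (h * (p₁ + 4 * q₁) + p₁ + 12 * q₁) ≡
          32 * ((6 + h * 4) * (p + 4 * q) + p + 12 * q)
    eq₂ = solve-∀

ladder⁺-direct : ∀ h → Ladder⁺ h (4 + 2 * h)
ladder⁺-direct h = ladder λ {p} {q} {k} → weaken (ℕₚ.≤-reflexive (cost h k)) ∘
  reduce 1 (eq₁ h p q) (eq₂ h p q) ∘ shunt 0 ∘ series^ (2 * h) ∘ shunt 2
  where
  cost : ∀ h k → 1 + (2 * h + (3 + k)) ≡ 4 + 2 * h + k
  cost = solve-∀
  eq₁ : ∀ h p q → 2 * (4 * p + 2 * h * (4 * q + p)) ≡ 2 * (2 * h * (p + 4 * q) + 4 * p)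
  eq₁ = solve-∀
  eq₂ : ∀ h p q → 2 * (4 * q + p) + (4 * p + 2 * h * (4 * q + p)) ≡
        2 * (h * (p + 4 * q) + 3 * p + 4 * q)
  eq₂ = solve-∀

-- A Π-circuit: n = 8 + 2m in series between the conductances (2 + m)/n and m/(2n).
ladder⁻-direct : ∀ m → Ladder⁻ m ((2 + m) * (7 + 2 * m) + (8 + 2 * m + m * (15 + 4 * m)))
ladder⁻-direct m = ladder λ {p} {q} {k} → weaken (ℕₚ.≤-reflexive (cost m k)) ∘
  reduce (31 + 16 * m + 2 * m * m) (eq₁ m p q) (eq₂ m p q) ∘
  shunt^ (6 + 2 * m) (2 + m) ∘ series^ (8 + 2 * m) ∘ shunt^ (14 + 4 * m) m
  where
  cost : ∀ m k → (2 + m) * (7 + 2 * m) + (8 + 2 * m + (m * (15 + 4 * m) + k)) ≡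
         (2 + m) * (7 + 2 * m) + (8 + 2 * m + m * (15 + 4 * m)) + k
  cost = solve-∀
  eq₁ : ∀ m p q → let p₁ = (16 + 4 * m) * p; q₁ = (16 + 4 * m) * q + m * p in
        (8 + 2 * m) * (p₁ + (8 + 2 * m) * q₁) ≡
        (32 + 16 * m + 2 * m * m) * (2 * m * (p + 4 * q) + 4 * p + 32 * q)
  eq₁ = solve-∀
  eq₂ : ∀ m p q → let p₁ = (16 + 4 * m) * p; q₁ = (16 + 4 * m) * q + m * p in
        (8 + 2 * m) * q₁ + (2 + m) * (p₁ + (8 + 2 * m) * q₁) ≡
        (32 + 16 * m + 2 * m * m) * (m * (p + 4 * q) + p + 12 * q)
  eq₂ = solve-∀

quarter-< : ∀ a r {q j} → a + (r + q * 4) < 4 ^ suc j → q < 4 ^ j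
quarter-< a r {q} {j} lt = ℕₚ.*-cancelˡ-< 4 q (4 ^ j) (ℕₚ.≤-<-trans bound lt)
  where
  bound : 4 * q ≤ a + (r + q * 4)
  bound = ℕₚ.≤-trans (ℕₚ.≤-reflexive (ℕₚ.*-comm 4 q))
    (ℕₚ.≤-trans (ℕₚ.m≤n+m (q * 4) r) (ℕₚ.m≤n+m (r + q * 4) a))

-- The constant 312 is the cost of `ladder⁻-direct 5`, the dearest base case; the smallest shift of
-- a negative step is 6.
ladder-cost : ℕ → ℕ
ladder-cost j = j * 16 + 312

section-cost : ∀ j → 16 + ladder-cost j ≤ ladder-cost (suc j)
section-cost j = ℕₚ.≤-reflexive (eq j 312)
  where
  eq : ∀ j c → 16 + (j * 16 + c) ≡ (1 + j) * 16 + c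
  eq = solve-∀

direct-cost : ∀ j {c} → c ≤ 312 → c ≤ ladder-cost j
direct-cost j c≤312 = ℕₚ.≤-trans c≤312 (ℕₚ.m≤n+m 312 (j * 16))

ladder⁺ : ∀ j {h} → h < 4 ^ j → Ladder⁺ h (ladder-cost j)
ladder⁺ j       {0} _ = weaken⁺ (direct-cost j (ℕₚ.≤ᵇ⇒≤ 4 312 tt)) (ladder⁺-direct 0)
ladder⁺ j       {1} _ = weaken⁺ (direct-cost j (ℕₚ.≤ᵇ⇒≤ 6 312 tt)) (ladder⁺-direct 1)
ladder⁺ j       {2} _ = weaken⁺ (direct-cost j (ℕₚ.≤ᵇ⇒≤ 8 312 tt)) (ladder⁺-direct 2)
ladder⁺ zero    {suc (suc (suc _))} (s≤s ())
ladder⁺ (suc j) {suc (suc (suc h))} lt with h DivMod.divMod 4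
... | DivMod.result q zero refl =
  weaken⁺ (section-cost j) (ladder⁺-3 (ladder⁺ j (quarter-< 3 0 {q} {j} lt)))
... | DivMod.result q (suc zero) refl =
  weaken⁺ (section-cost j) (ladder⁺-4 (ladder⁺ j (quarter-< 3 1 {q} {j} lt)))
... | DivMod.result q (suc (suc zero)) refl =
  weaken⁺ (section-cost j) (ladder⁺-5 (ladder⁺ j (quarter-< 3 2 {q} {j} lt)))
... | DivMod.result q (suc (suc (suc zero))) refl =
  weaken⁺ (section-cost j) (ladder⁺-6 (ladder⁺ j (quarter-< 3 3 {q} {j} lt)))

ladder⁻ : ∀ j {h} → h < 4 ^ j → Ladder⁻ h (ladder-cost j)
ladder⁻ j       {0} _ = weaken⁻ (direct-cost j (ℕₚ.≤ᵇ⇒≤ 22 312 tt)) (ladder⁻-direct 0)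
ladder⁻ j       {1} _ = weaken⁻ (direct-cost j (ℕₚ.≤ᵇ⇒≤ 56 312 tt)) (ladder⁻-direct 1)
ladder⁻ j       {2} _ = weaken⁻ (direct-cost j (ℕₚ.≤ᵇ⇒≤ 102 312 tt)) (ladder⁻-direct 2)
ladder⁻ j       {3} _ = weaken⁻ (direct-cost j (ℕₚ.≤ᵇ⇒≤ 160 312 tt)) (ladder⁻-direct 3)
ladder⁻ j       {4} _ = weaken⁻ (direct-cost j (ℕₚ.≤ᵇ⇒≤ 230 312 tt)) (ladder⁻-direct 4)
ladder⁻ j       {5} _ = weaken⁻ (direct-cost j (ℕₚ.≤ᵇ⇒≤ 312 312 tt)) (ladder⁻-direct 5)
ladder⁻ zero    {suc (suc (suc (suc (suc (suc _)))))} (s≤s ())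
ladder⁻ (suc j) {suc (suc (suc (suc (suc (suc h)))))} lt with h DivMod.divMod 4
... | DivMod.result q zero refl =
  weaken⁻ (section-cost j) (ladder⁻-6 (ladder⁻ j (quarter-< 6 0 {q} {j} lt)))
... | DivMod.result q (suc zero) refl =
  weaken⁻ (section-cost j) (ladder⁻-7 (ladder⁻ j (quarter-< 6 1 {q} {j} lt)))
... | DivMod.result q (suc (suc zero)) refl =
  weaken⁻ (section-cost j) (ladder⁻-8 (ladder⁻ j (quarter-< 6 2 {q} {j} lt)))
... | DivMod.result q (suc (suc (suc zero))) refl =
  weaken⁻ (section-cost j) (ladder⁻-9 (ladder⁻ j (quarter-< 6 3 {q} {j} lt)))

-- Continued fractions

power-bracket : ∀ a → ∃ λ κ → 4 ^ κ ≤ suc a × suc a < 4 ^ suc κ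
power-bracket zero    = 0 , ℕₚ.≤-refl , s≤s (s≤s z≤n)
power-bracket (suc a) with power-bracket a
... | κ , lo , hi with suc (suc a) ℕₚ.<? 4 ^ suc κ
...   | yes lt = κ , ℕₚ.m≤n⇒m≤1+n lo , lt
...   | no ≮   = suc κ , ℕₚ.≮⇒≥ ≮ ,
  ℕₚ.≤-<-trans hi (ℕₚ.^-monoʳ-< 4 (s≤s (s≤s z≤n)) (ℕₚ.n<1+n (suc κ)))

euclid : ∀ p q → 0 < q → ∃₂ λ j r → p ≡ r + j * q × r < q
euclid p q 0<q = p DivMod./ q , p DivMod.% q , DivMod.m≡m%n+[m/n]*n p q , DivMod.m%n<n p q
  where instance q≢0 = >-nonZero 0<q

exponent : ∀ {q b} e → 0 < q → q * 2 ^ suc e < 2 ^ (2 + b) → ∃ λ b′ → b′ + e ≡ suc b × q < 2 ^ b′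
exponent {q} {b} e 0<q lt with e ℕₚ.≤? suc b
... | no ≰ = contradiction (ℕₚ.<-≤-trans lt (begin
    2 ^ (2 + b)       ≤⟨ ℕₚ.^-monoʳ-≤ 2 (ℕₚ.m≤n⇒m≤1+n (ℕₚ.≰⇒> ≰)) ⟩
    2 ^ suc e         ≡⟨ ℕₚ.*-identityˡ (2 ^ suc e) ⟨
    1 * 2 ^ suc e     ≤⟨ ℕₚ.*-monoˡ-≤ (2 ^ suc e) 0<q ⟩
    q * 2 ^ suc e     ∎)) (ℕₚ.<-irrefl refl)
  where open ℕₚ.≤-Reasoning
... | yes le with ℕₚ.m≤n⇒∃[o]m+o≡n le
...   | b′ , eq = b′ , trans (ℕₚ.+-comm b′ e) eq ,
  ℕₚ.*-cancelʳ-< (2 ^ suc e) q (2 ^ b′) (subst (q * 2 ^ suc e <_)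
    (trans (cong (λ x → 2 ^ suc x) (sym eq))
      (trans (ℕₚ.^-distribˡ-+-* 2 (suc e) b′) (ℕₚ.*-comm (2 ^ suc e) (2 ^ b′)))) lt)

-- A gadget for a large quotient a ≈ 4^κ divides the denominator q by a, up to the factor 3/2.
shrink : ∀ {a b q q′ r} → 4 ≤ a → 0 < q′ → q′ ≤ 3 * r → 2 * a * r ≤ q → q < 2 ^ b →
         ∃₂ λ κ b′ → a < 4 ^ suc κ × 1 ≤ κ × b′ + 2 * κ ≡ suc b × q′ < 2 ^ b′
shrink {suc a} {b} {q} {q′} {r} 4≤a 0<q′ q′≤3r 2ar≤q q<2^b with power-bracket a
... | zero , _ , a<4 = contradiction (ℕₚ.<-≤-trans a<4 4≤a) (ℕₚ.<-irrefl refl)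
... | suc κ , lo , hi = let b′ , eq , q′< = exponent (2 * suc κ) 0<q′ scaled in
  suc κ , b′ , hi , s≤s z≤n , eq , q′<
  where
  reorder : ∀ r a → 3 * r * (2 * a) ≡ 3 * (2 * a * r)
  reorder = solve-∀
  scaled : q′ * 2 ^ suc (2 * suc κ) < 2 ^ (2 + b)
  scaled = begin-strict
    q′ * (2 * 2 ^ (2 * suc κ))  ≡⟨ cong (λ x → q′ * (2 * x)) (ℕₚ.^-*-assoc 2 2 (suc κ)) ⟨
    q′ * (2 * 4 ^ suc κ)        ≤⟨ ℕₚ.*-mono-≤ q′≤3r (ℕₚ.*-monoʳ-≤ 2 lo) ⟩
    3 * r * (2 * suc a)         ≡⟨ reorder r (suc a) ⟩
    3 * (2 * suc a * r)         ≤⟨ ℕₚ.*-monoʳ-≤ 3 2ar≤q ⟩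
    3 * q                       ≤⟨ ℕₚ.*-monoˡ-≤ q (ℕₚ.n≤1+n 3) ⟩
    4 * q                       <⟨ ℕₚ.*-monoʳ-< 4 q<2^b ⟩
    4 * 2 ^ b                   ≡⟨ ℕₚ.*-assoc 2 2 (2 ^ b) ⟩
    2 ^ (2 + b)                 ∎
    where open ℕₚ.≤-Reasoning

-- The gadget frees `2 * κ - 1` digits, each worth 400. The tightest case is `κ = 1`, where 400 =
-- 384 + 16.
gadget-budget : ∀ {b b′ κ} c → c ≤ 384 → 1 ≤ κ → b′ + 2 * κ ≡ suc b →
                c + κ * 16 + b′ * 400 ≤ b * 400
gadget-budget {b} {b′} {suc κ} c c≤384 _ eq = begin
  c + suc κ * 16 + b′ * 400          ≤⟨ ℕₚ.+-monoˡ-≤ (b′ * 400) (ℕₚ.+-monoˡ-≤ (suc κ * 16) c≤384) ⟩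
  384 + suc κ * 16 + b′ * 400        ≤⟨ ℕₚ.m≤m+n _ (784 * κ) ⟩
  384 + suc κ * 16 + b′ * 400 + 784 * κ ≡⟨ reorder κ b′ ⟩
  (b′ + (1 + 2 * κ)) * 400           ≡⟨ cong (_* 400) (ℕₚ.suc-injective (trans (shift b′ κ) eq)) ⟩
  b * 400                            ∎
  where
  open ℕₚ.≤-Reasoning
  reorder : ∀ κ b′ → 384 + (1 + κ) * 16 + b′ * 400 + 784 * κ ≡ (b′ + (1 + 2 * κ)) * 400
  reorder = solve-∀
  shift : ∀ b′ κ → 1 + (b′ + (1 + 2 * κ)) ≡ b′ + 2 * (1 + κ)
  shift = solve-∀

Bounded : ℕ → Set
Bounded b = ∀ {p q} → 0 < q → q ≤ p → p ≤ 13 * q → q < 2 ^ b → Realisable p q (b * 400)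

-- For y = (r + σ)/r the load 4y/(4 - y) equals `4 * (r + σ)` over `r + ρ`. As y runs from 1 to 3 it
-- runs from 4/3 to 12, within the range of `Bounded`.
window : ∀ r {ρ σ} → ρ + σ ≡ 2 * r →
         r + ρ ≤ 3 * r × r + ρ ≤ 4 * (r + σ) × 4 * (r + σ) ≤ 13 * (r + ρ)
window r {ρ} {σ} eq = r+ρ≤3r , lower , upper
  where
  open ℕₚ.≤-Reasoning
  3r : ∀ r → r + 2 * r ≡ 3 * r
  3r = solve-∀
  r+ρ≤3r : r + ρ ≤ 3 * r
  r+ρ≤3r = begin
    r + ρ       ≤⟨ ℕₚ.+-monoʳ-≤ r (ℕₚ.m≤m+n ρ σ) ⟩
    r + (ρ + σ) ≡⟨ cong (r +_) eq ⟩
    r + 2 * r   ≡⟨ 3r r ⟩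
    3 * r       ∎
  lower : r + ρ ≤ 4 * (r + σ)
  lower = begin
    r + ρ       ≤⟨ r+ρ≤3r ⟩
    3 * r       ≤⟨ ℕₚ.*-mono-≤ (ℕₚ.n≤1+n 3) (ℕₚ.m≤m+n r σ) ⟩
    4 * (r + σ) ∎
  upper : 4 * (r + σ) ≤ 13 * (r + ρ)
  upper = begin
    4 * (r + σ)        ≤⟨ ℕₚ.*-monoʳ-≤ 4 (ℕₚ.+-monoʳ-≤ r (ℕₚ.m≤n+m σ ρ)) ⟩
    4 * (r + (ρ + σ))  ≡⟨ cong (λ x → 4 * (r + x)) eq ⟩
    4 * (r + 2 * r)    ≡⟨ 12r r ⟩
    12 * r             ≤⟨ ℕₚ.*-mono-≤ (ℕₚ.n≤1+n 12) (ℕₚ.m≤m+n r ρ) ⟩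
    13 * (r + ρ)       ∎
    where
    12r : ∀ r → 4 * (r + 2 * r) ≡ 12 * r
    12r = solve-∀

quotient-≤ : ∀ {c a ρ d} → c * d ≤ ρ + a * d → ρ < d → c ≤ a
quotient-≤ {c} {a} {ρ} {d} le ρ<d = ℕₚ.≤-pred (ℕₚ.*-cancelʳ-< d c (suc a)
  (ℕₚ.≤-<-trans le (ℕₚ.+-monoˡ-< (a * d) ρ<d)))

-- The divisor is `2 * r` because ladders provide only even resistors.
halve : ∀ q r → 0 < r → ∃ λ a → ∃₂ λ ρ σ → q ≡ ρ + a * (2 * r) × ρ < 2 * r × ρ + σ ≡ 2 * r
halve q r 0<r with euclid q (2 * r) (ℕₚ.≤-trans 0<r (ℕₚ.m≤m+n r (r + 0)))
... | a , ρ , q≡ , ρ<2r = let σ , eq = ℕₚ.m≤n⇒∃[o]m+o≡n (ℕₚ.<⇒≤ ρ<2r) in a , ρ , σ , q≡ , ρ<2r , eq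

-- Write q = ρ + (2 + m)(2r).  Then 1 + r/q has conductance 1 - 1/(n - y) with n = 8 + 2m and
-- y = (r + σ)/r in (1, 3], and the load 4y/(4 - y) gives 4 ∥ load = y.
module _ (m r ρ : ℕ) {σ : ℕ} (eq : ρ + σ ≡ 2 * r) where
  private
    p = 4 * (r + σ)
    q = r + ρ
    X = 2 * m * (p + 4 * q) + 4 * p + 32 * q
    Y = m * (p + 4 * q) + p + 12 * q

  near-one-numerator : 2 * X ≡ 32 * (ρ + (2 + m) * (2 * r) + r)
  near-one-numerator =
    trans (expand m r ρ σ) (trans (cong (form m r ρ) eq) (collect m r ρ))
    where
    form : ℕ → ℕ → ℕ → ℕ → ℕ
    form m r ρ s = 2 * (2 * m * (8 * r + 4 * s) + 48 * r + 16 * ρ + 16 * s)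
    expand : ∀ m r ρ σ → 2 * (2 * m * (4 * (r + σ) + 4 * (r + ρ)) + 4 * (4 * (r + σ)) + 32 * (r + ρ)) ≡
             2 * (2 * m * (8 * r + 4 * (ρ + σ)) + 48 * r + 16 * ρ + 16 * (ρ + σ))
    expand = solve-∀
    collect : ∀ m r ρ → 2 * (2 * m * (8 * r + 4 * (2 * r)) + 48 * r + 16 * ρ + 16 * (2 * r)) ≡
              32 * (ρ + (2 + m) * (2 * r) + r)
    collect = solve-∀

  near-one-denominator : 2 * Y + X ≡ 32 * (ρ + (2 + m) * (2 * r))
  near-one-denominator =
    trans (expand m r ρ σ) (trans (cong (form m r ρ) eq) (collect m r ρ))
    where
    form : ℕ → ℕ → ℕ → ℕ → ℕ
    form m r ρ s = 2 * (m * (8 * r + 4 * s) + 16 * r + 8 * ρ + 4 * s) +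
                   (2 * m * (8 * r + 4 * s) + 48 * r + 16 * ρ + 16 * s)
    expand : ∀ m r ρ σ → 2 * (m * (4 * (r + σ) + 4 * (r + ρ)) + 4 * (r + σ) + 12 * (r + ρ)) +
             (2 * m * (4 * (r + σ) + 4 * (r + ρ)) + 4 * (4 * (r + σ)) + 32 * (r + ρ)) ≡
             2 * (m * (8 * r + 4 * (ρ + σ)) + 16 * r + 8 * ρ + 4 * (ρ + σ)) +
             (2 * m * (8 * r + 4 * (ρ + σ)) + 48 * r + 16 * ρ + 16 * (ρ + σ))
    expand = solve-∀
    collect : ∀ m r ρ → 2 * (m * (8 * r + 4 * (2 * r)) + 16 * r + 8 * ρ + 4 * (2 * r)) +
              (2 * m * (8 * r + 4 * (2 * r)) + 48 * r + 16 * ρ + 16 * (2 * r)) ≡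
              32 * (ρ + (2 + m) * (2 * r))
    collect = solve-∀

-- Here r₁/r = 2h + y with y = (r + ρ)/r in [1, 3), and again the load is 4y/(4 - y).
module _ (h r ρ : ℕ) {σ : ℕ} (eq : ρ + σ ≡ 2 * r) where
  private
    p = 4 * (r + ρ)
    q = r + σ
    r₁ = r + (ρ + h * (2 * r))

  far-numerator : 2 * h * (p + 4 * q) + 4 * p ≡ 8 * (2 * r₁)
  far-numerator = trans (expand h r ρ σ) (trans (cong (form h r ρ) eq) (collect h r ρ))
    where
    form : ℕ → ℕ → ℕ → ℕ → ℕ
    form h r ρ s = 2 * h * (8 * r + 4 * s) + 16 * r + 16 * ρ
    expand : ∀ h r ρ σ → 2 * h * (4 * (r + ρ) + 4 * (r + σ)) + 4 * (4 * (r + ρ)) ≡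
             2 * h * (8 * r + 4 * (ρ + σ)) + 16 * r + 16 * ρ
    expand = solve-∀
    collect : ∀ h r ρ → 2 * h * (8 * r + 4 * (2 * r)) + 16 * r + 16 * ρ ≡
              8 * (2 * (r + (ρ + h * (2 * r))))
    collect = solve-∀

  far-denominator : h * (p + 4 * q) + 3 * p + 4 * q ≡ 8 * (r₁ + 2 * r)
  far-denominator = trans (expand h r ρ σ) (trans (cong (form h r ρ) eq) (collect h r ρ))
    where
    form : ℕ → ℕ → ℕ → ℕ → ℕ
    form h r ρ s = h * (8 * r + 4 * s) + 16 * r + 8 * ρ + 4 * s
    expand : ∀ h r ρ σ → h * (4 * (r + ρ) + 4 * (r + σ)) + 3 * (4 * (r + ρ)) + 4 * (r + σ) ≡
             h * (8 * r + 4 * (ρ + σ)) + 16 * r + 8 * ρ + 4 * (ρ + σ)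
    expand = solve-∀
    collect : ∀ h r ρ → h * (8 * r + 4 * (2 * r)) + 16 * r + 8 * ρ + 4 * (2 * r) ≡
              8 * (r + (ρ + h * (2 * r)) + 2 * r)
    collect = solve-∀

positive-exponent : ∀ {q b} → 0 < q → q < 2 ^ b → 0 < b
positive-exponent {b = zero}  0<q q<1 = contradiction (ℕₚ.<-≤-trans q<1 0<q) (ℕₚ.<-irrefl refl)
positive-exponent {b = suc b} _   _   = z<s

module Step (b : ℕ) (rec : ∀ {b′} → b′ < b → Bounded b′) where

  smaller : ∀ {b′ κ} → 1 ≤ κ → b′ + 2 * κ ≡ suc b → b′ < b
  smaller {b′} {suc κ} _ eq = ℕₚ.≤-trans (ℕₚ.m≤m+n (suc b′) (2 * κ))
    (ℕₚ.≤-reflexive (ℕₚ.suc-injective (trans (shift b′ κ) eq)))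
    where
    shift : ∀ b′ κ → 1 + (1 + b′ + 2 * κ) ≡ b′ + 2 * (1 + κ)
    shift = solve-∀

  -- The slack 12 pays for up to twelve unit resistors in series.
  Near : ℕ → ℕ → Set
  Near p q = ∃ λ k → 12 + k ≤ b * 400 × Realisable p q k

  constant-budget : ∀ {q c} → 0 < q → q < 2 ^ b → c ≤ 400 → c ≤ b * 400
  constant-budget 0<q q<2^b c≤400 =
    ℕₚ.≤-trans c≤400 (ℕₚ.*-monoˡ-≤ 400 (positive-exponent {b = b} 0<q q<2^b))

  -- Two paths of two edges give unit resistance without an edge between the terminals.
  exactly-one : ∀ {q} → 0 < q → q < 2 ^ b → Near (q + 0) q
  exactly-one {q} 0<q q<2^b = 3 , constant-budget 0<q q<2^b (ℕₚ.≤ᵇ⇒≤ 15 400 tt) ,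
    recast (eq q) (ℕₚ.*-identityʳ q) (multiply q (reduce 1 refl refl (shunt^ 0 2 open-circuit)))
    where
    eq : ∀ q → q * 1 ≡ q + 0
    eq = solve-∀

  -- The conductance sought is slightly below 1. Two shunts of 2, one inside the ladder and one
  -- added here, supply the 1, and the negative resistor takes away the excess. The threshold 8
  -- makes the quotient by `2 * r` at least 4, as `shrink` demands.
  near-one : ∀ {q r} → 0 < r → 8 * r ≤ q → q < 2 ^ b → Near (q + r) q
  near-one {q} {r} 0<r 8r≤q q<2^b with halve q r 0<r
  ... | a , ρ , σ , refl , ρ<2r , eq with quotient-≤ {4} {a} (ℕₚ.≤-trans (ℕₚ.≤-reflexive (8r r)) 8r≤q) ρ<2r
    where
    8r : ∀ r → 4 * (2 * r) ≡ 8 * r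
    8r = solve-∀
  near-one {q} {r} 0<r 8r≤q q<2^b | suc (suc m) , ρ , σ , refl , ρ<2r , eq | 4≤a@(s≤s (s≤s _)) =
    let q′≤3r , q′≤p′ , p′≤13q′ = window r eq
        0<q′ = ℕₚ.≤-trans 0<r (ℕₚ.m≤m+n r ρ)
        κ , b′ , a< , 1≤κ , b′≡ , q′<2^b′ =
          shrink {r = r} 4≤a 0<q′ q′≤3r (ℕₚ.≤-trans (ℕₚ.≤-reflexive (2ar (2 + m) r)) (ℕₚ.m≤n+m _ ρ)) q<2^b
        m< = ℕₚ.<-trans (ℕₚ.m<n⇒m<1+n (ℕₚ.n<1+n m)) a<
    in  1 + (ladder-cost (suc κ) + b′ * 400) ,
        ℕₚ.≤-trans (ℕₚ.≤-reflexive (cost κ (b′ * 400)))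
          (gadget-budget {b} {b′} {κ} 341 (ℕₚ.≤ᵇ⇒≤ 341 384 tt) 1≤κ b′≡) ,
        reduce 31 (near-one-numerator m r ρ eq) (near-one-denominator m r ρ eq)
          (shunt 0 (Ladder⁻.load (ladder⁻ (suc κ) m<)
            (rec {b′} (smaller {b′} {κ} 1≤κ b′≡) 0<q′ q′≤p′ p′≤13q′ q′<2^b′)))
    where
    2ar : ∀ a r → 2 * a * r ≡ a * (2 * r)
    2ar = solve-∀
    cost : ∀ κ x → 12 + (1 + ((1 + κ) * 16 + 312 + x)) ≡ 341 + κ * 16 + x
    cost = solve-∀

  -- Two Euclidean steps at once: the quotient of `q` by `r`, at most 7, becomes a bundle of shunts
  -- of 2; the quotient of `r` by `r₂` becomes a `Ladder⁺` if it is large and plain resistors in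
  -- series if not.
  far-from-one : ∀ {q r} → 0 < r → r < q → q < 8 * r → q < 2 ^ b → Near (q + r) q
  far-from-one {q} {r} 0<r r<q q<8r q<2^b with euclid q r 0<r
  ... | zero , r₂ , refl , r₂<r =
    contradiction (ℕₚ.<-trans r<q (subst (_< r) (sym (ℕₚ.+-identityʳ r₂)) r₂<r)) (ℕₚ.<-irrefl refl)
  ... | suc k , r₂ , refl , r₂<r = split r₂ r₂<r r<q q<8r q<2^b
    where
    add-one : ∀ {q K} → Realisable r q K → Realisable (q + r) q (suc K)
    add-one {q} = recast (ℕₚ.+-comm r q) refl ∘ series

    k≤6 : ∀ r₂ → r₂ + suc k * r < 8 * r → k ≤ 6
    k≤6 r₂ lt = ℕₚ.≤-pred (ℕₚ.≤-pred (ℕₚ.*-cancelʳ-< r (suc k) 8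
      (ℕₚ.≤-<-trans (ℕₚ.m≤n+m (suc k * r) r₂) lt)))

    split : ∀ r₂ → r₂ < r → r < r₂ + suc k * r → r₂ + suc k * r < 8 * r → r₂ + suc k * r < 2 ^ b →
            Near (r₂ + suc k * r + r) (r₂ + suc k * r)
    split zero _ _ q<8r q<2^b = suc (2 * suc k * 1 + 1) ,
      constant-budget (ℕₚ.≤-trans 0<r (ℕₚ.m≤m+n r (k * r))) q<2^b
        (ℕₚ.≤-trans (ℕₚ.+-monoʳ-≤ 13 (ℕₚ.+-monoˡ-≤ 1 (ℕₚ.*-monoˡ-≤ 1 (ℕₚ.*-monoʳ-≤ 2 (s≤s (k≤6 0 q<8r))))))
          (ℕₚ.≤ᵇ⇒≤ 28 400 tt)) ,
      add-one (recast (ℕₚ.*-identityʳ r) (ℕₚ.*-comm r (suc k))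
        (multiply r (reduce 1 refl (eq k) (shunt^ 0 (2 * suc k) open-circuit))))
      where
      eq : ∀ k → 2 * 0 + 2 * (1 + k) * 1 ≡ 2 * (1 + k)
      eq = solve-∀
    split r₂@(suc _) r₂<r r<q q<8r q<2^b with ℕₚ.m≤n⇒∃[o]m+o≡n (ℕₚ.<⇒≤ r₂<r)
    ... | δ , r≡ with halve δ r₂ z<s
    ... | h , ρ , σ , refl , ρ<2r₂ , eq with 4 ℕₚ.≤? h
    ... | yes 4≤h =
      let q′≤3r₂ , q′≤p′ , p′≤13q′ = window r₂ (trans (ℕₚ.+-comm σ ρ) eq)
          κ , b′ , h< , 1≤κ , b′≡ , q′<2^b′ = shrink {r = r₂} 4≤h z<s q′≤3r₂ 2hr₂≤q q<2^b
      in  suc ((1 + 2 * k) * 1 + (ladder-cost (suc κ) + b′ * 400)) ,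
          ℕₚ.≤-trans (ℕₚ.≤-reflexive (cost k κ (b′ * 400)))
            (ℕₚ.≤-trans (ℕₚ.+-monoˡ-≤ (341 + κ * 16 + b′ * 400) 1+2k≤13)
              (gadget-budget {b} {b′} {κ} 354 (ℕₚ.≤ᵇ⇒≤ 354 384 tt) 1≤κ b′≡)) ,
          -- Conductance `suc k` takes `2 + 2 * k` shunts of 2; the ladder already contains one of
          -- them.
          add-one (reduce 3 (sym (ℕₚ.*-assoc 2 2 r)) (denominator r₂ r k) (shunt^ 0 (1 + 2 * k)
            (recast (cong (2 *_) r≡) (cong (_+ 2 * r₂) r≡)
              (reduce 7 (far-numerator h r₂ ρ eq) (far-denominator h r₂ ρ eq)
                (Ladder⁺.load (ladder⁺ (suc κ) h<)
                  (rec {b′} (smaller {b′} {κ} 1≤κ b′≡) z<s q′≤p′ p′≤13q′ q′<2^b′))))))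
      where
      2hr₂≤q : 2 * h * r₂ ≤ r₂ + suc k * r
      2hr₂≤q = begin
        2 * h * r₂                 ≡⟨ 2hr h r₂ ⟩
        h * (2 * r₂)               ≤⟨ ℕₚ.≤-trans (ℕₚ.m≤n+m _ ρ) (ℕₚ.m≤n+m _ r₂) ⟩
        r₂ + (ρ + h * (2 * r₂))    ≡⟨ r≡ ⟩
        r                          ≤⟨ ℕₚ.<⇒≤ r<q ⟩
        r₂ + suc k * r             ∎
        where
        open ℕₚ.≤-Reasoning
        2hr : ∀ h r → 2 * h * r ≡ h * (2 * r)
        2hr = solve-∀
      1+2k≤13 : 1 + 2 * k ≤ 13
      1+2k≤13 = s≤s (ℕₚ.*-monoʳ-≤ 2 (k≤6 r₂ q<8r))
      cost : ∀ k κ x → 12 + (1 + ((1 + 2 * k) * 1 + ((1 + κ) * 16 + 312 + x))) ≡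
             1 + 2 * k + (341 + κ * 16 + x)
      cost = solve-∀
      denominator : ∀ r₂ r k → 2 * (r + 2 * r₂) + (1 + 2 * k) * (2 * r) ≡ 4 * (r₂ + (1 + k) * r)
      denominator = solve-∀
    ... | no 4≰h =
      let p′≤3r₂ , _ , _ = window r₂ eq
          -- From `r₂ < r` and `r₂ + r ≤ q` the denominator at least halves, so one digit is freed,
          -- as with `κ = 1`.
          b′ , b′≡ , r₂<2^b′ = exponent 2 z<s 8r₂<2^2+b
      in  suc (2 * suc k * 1 + (2 * h + b′ * 400)) ,
          ℕₚ.≤-trans (ℕₚ.≤-reflexive (cost k h (b′ * 400)))
            (ℕₚ.≤-trans (ℕₚ.+-monoˡ-≤ (b′ * 400) small)
              (gadget-budget {b} {b′} {1} 33 (ℕₚ.≤ᵇ⇒≤ 33 384 tt) ℕₚ.≤-refl b′≡)) ,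
          add-one (reduce 1 refl (denominator r₂ r k) (shunt^ 0 (2 * suc k)
            (recast (trans (numerator h r₂ ρ) r≡) refl (series^ (2 * h)
              (rec {b′} (smaller {b′} {1} ℕₚ.≤-refl b′≡) z<s (ℕₚ.m≤m+n r₂ ρ)
                (ℕₚ.≤-trans p′≤3r₂ (ℕₚ.*-monoˡ-≤ r₂ (ℕₚ.≤ᵇ⇒≤ 3 13 tt))) r₂<2^b′)))))
      where
      8r₂<2^2+b : r₂ * 8 < 2 ^ (2 + b)
      8r₂<2^2+b = begin-strict
        r₂ * 8                ≡⟨ 8r r₂ ⟩
        4 * (r₂ + r₂)         ≤⟨ ℕₚ.*-monoʳ-≤ 4 (ℕₚ.+-monoʳ-≤ r₂ (ℕₚ.≤-trans (ℕₚ.<⇒≤ r₂<r)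
                                   (ℕₚ.m≤m+n r (k * r)))) ⟩
        4 * (r₂ + suc k * r)  <⟨ ℕₚ.*-monoʳ-< 4 q<2^b ⟩
        4 * 2 ^ b             ≡⟨ ℕₚ.*-assoc 2 2 (2 ^ b) ⟩
        2 ^ (2 + b)           ∎
        where
        open ℕₚ.≤-Reasoning
        8r : ∀ r → r * 8 ≡ 4 * (r + r)
        8r = solve-∀
      small : 15 + 2 * k + 2 * h ≤ 33 + 1 * 16
      small = ℕₚ.≤-trans (ℕₚ.+-mono-≤ (ℕₚ.+-monoʳ-≤ 15 (ℕₚ.*-monoʳ-≤ 2 (k≤6 r₂ q<8r)))
        (ℕₚ.*-monoʳ-≤ 2 (ℕₚ.≤-pred (ℕₚ.≰⇒> 4≰h)))) (ℕₚ.≤ᵇ⇒≤ 33 49 tt)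
      cost : ∀ k h x → 12 + (1 + (2 * (1 + k) * 1 + (2 * h + x))) ≡ 15 + 2 * k + 2 * h + x
      cost = solve-∀
      numerator : ∀ h r ρ → r + ρ + 2 * h * r ≡ r + (ρ + h * (2 * r))
      numerator = solve-∀
      denominator : ∀ r₂ r k → 2 * r₂ + 2 * (1 + k) * r ≡ 2 * (r₂ + (1 + k) * r)
      denominator = solve-∀

  bounded-step : Bounded b
  bounded-step {p} {q} 0<q q≤p p≤13q q<2^b with euclid p q 0<q
  ... | zero , r , refl , r<q =
    contradiction (ℕₚ.≤-<-trans q≤p (subst (_< q) (sym (ℕₚ.+-identityʳ r)) r<q)) (ℕₚ.<-irrefl refl)
  ... | suc j , r , refl , r<q = add-series (near r r<q)
    where
    near : ∀ r → r < q → Near (q + r) q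
    near zero      _   = exactly-one 0<q q<2^b
    near r@(suc _) r<q with 8 * r ℕₚ.≤? q
    ... | yes 8r≤q = near-one z<s 8r≤q q<2^b
    ... | no 8r≰q  = far-from-one z<s r<q (ℕₚ.≰⇒> 8r≰q) q<2^b
    j≤12 : j ≤ 12
    j≤12 = ℕₚ.≤-pred (ℕₚ.*-cancelʳ-≤ (suc j) 13 q (ℕₚ.≤-trans (ℕₚ.m≤n+m (suc j * q) r) p≤13q))
      where instance q≢0 = >-nonZero 0<q
    add-series : Near (q + r) q → Realisable (r + suc j * q) q (b * 400)
    add-series (k , budget , R) = weaken (ℕₚ.≤-trans (ℕₚ.+-monoˡ-≤ k j≤12) budget)
      (recast (eq q r j) refl (series^ j R))
      where
      eq : ∀ q r j → q + r + j * q ≡ r + (1 + j) * q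
      eq = solve-∀

bounded : ∀ b → Bounded b
bounded = <-rec Bounded Step.bounded-step

-- The bound on the number of vertices

<2^log₂ : ∀ t → t < 2 ^ suc ⌊log₂ t ⌋
<2^log₂ t = ℕₚ.≰⇒> λ 2^≤t → ℕₚ.<-irrefl refl
  (ℕₚ.≤-trans (ℕₚ.≤-reflexive (sym (⌊log₂[2^n]⌋≡n (suc ⌊log₂ t ⌋)))) (⌊log₂⌋-mono-≤ 2^≤t))

0<log₂ : ∀ {t} → 1 < t → 0 < ⌊log₂ t ⌋
0<log₂ = ⌊log₂⌋-mono-≤

-- The larger of `a` and `L` dominates the sum, and `0 < L` lets it absorb the additive constants.
size-bound : ∀ {k n} a L → 0 < L → n ≤ k → k ≤ a + suc L * 400 → suc n ≤ 802 * a ⊎ suc n ≤ 1604 * L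
size-bound {k} {n} a L 0<L n≤k k≤ with a ℕₚ.≤? L
... | yes a≤L = inj₂ (begin
  suc n                  ≤⟨ s≤s (ℕₚ.≤-trans n≤k k≤) ⟩
  suc (a + suc L * 400)  ≤⟨ ℕₚ.+-mono-≤ 0<L (ℕₚ.+-mono-≤ a≤L (ℕₚ.*-monoˡ-≤ 400 (ℕₚ.+-monoˡ-≤ L 0<L))) ⟩
  L + (L + (L + L) * 400) ≡⟨ eq L ⟩
  802 * L                ≤⟨ ℕₚ.*-monoˡ-≤ L (ℕₚ.≤ᵇ⇒≤ 802 1604 tt) ⟩
  1604 * L               ∎)
  where
  open ℕₚ.≤-Reasoning
  eq : ∀ L → L + (L + (L + L) * 400) ≡ 802 * L
  eq = solve-∀
... | no a≰L = inj₁ (begin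
  suc n                  ≤⟨ s≤s (ℕₚ.≤-trans n≤k k≤) ⟩
  suc (a + suc L * 400)  ≤⟨ ℕₚ.+-monoʳ-≤ 1 (ℕₚ.+-monoʳ-≤ a (ℕₚ.*-monoˡ-≤ 400 L<a)) ⟩
  1 + (a + a * 400)      ≤⟨ ℕₚ.+-monoˡ-≤ (a + a * 400) (ℕₚ.≤-trans (s≤s z≤n) L<a) ⟩
  a + (a + a * 400)      ≡⟨ eq a ⟩
  402 * a                ≤⟨ ℕₚ.*-monoˡ-≤ a (ℕₚ.≤ᵇ⇒≤ 402 802 tt) ⟩
  802 * a                ∎)
  where
  open ℕₚ.≤-Reasoning
  L<a : L < a
  L<a = ℕₚ.≰⇒> a≰L
  eq : ∀ a → a + (a + a * 400) ≡ 402 * a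
  eq = solve-∀

conclude : ∀ {C t c k} → c < t → (R : Realisable c (t ∸ c) k) → let n = Realisable.size R in
  suc n * c ≤ C * t ⊎ suc n * (t ∸ c) ≤ C * t ⊎ suc n ≤ C * ⌊log₂ t ⌋ →
  ∃ λ n → Σ (MGraph (suc n)) λ G → Σ (Simple G) λ s → Planar G ×
  Σ (Fin (length G)) λ e → ∃₂ λ a b →
  HasTau G a × HasTau (contract G e (Simple.loopless s e)) b ×
  0 < a × b * t ≡ a * c ×
  (suc n * c ≤ C * t ⊎ suc n * (t ∸ c) ≤ C * t ⊎ suc n ≤ C * ⌊log₂ t ⌋)
conclude {C} {t} {c} c<t (realisable {n} {F} {T} N _ 0<F ratio) size =
  let G , s , planar , e , τ , τ/e = realise N in
  n , G , s , planar , e , F + T , F , τ , τ/e , ℕₚ.<-≤-trans 0<F (ℕₚ.m≤m+n F T) , balance , size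
  where
  balance : F * t ≡ (F + T) * c
  balance = begin
    F * t                ≡⟨ cong (F *_) (ℕₚ.m+[n∸m]≡n (ℕₚ.<⇒≤ c<t)) ⟨
    F * (c + (t ∸ c))    ≡⟨ ℕₚ.*-distribˡ-+ F c (t ∸ c) ⟩
    F * c + F * (t ∸ c)  ≡⟨ cong (F * c +_) ratio ⟩
    F * c + T * c        ≡⟨ ℕₚ.*-distribʳ-+ c F T ⟨
    (F + T) * c          ∎
    where open ≡-Reasoning

size-* : ∀ {n a x y t} → suc n ≤ 802 * a → a * x ≤ y → y ≤ 2 * t → suc n * x ≤ 1604 * t
size-* {n} {a} {x} {y} {t} n≤ ax≤y y≤2t = begin
  suc n * x      ≤⟨ ℕₚ.*-monoˡ-≤ x n≤ ⟩
  802 * a * x    ≡⟨ ℕₚ.*-assoc 802 a x ⟩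
  802 * (a * x)  ≤⟨ ℕₚ.*-monoʳ-≤ 802 (ℕₚ.≤-trans ax≤y y≤2t) ⟩
  802 * (2 * t)  ≡⟨ ℕₚ.*-assoc 802 2 t ⟨
  1604 * t       ∎
  where open ℕₚ.≤-Reasoning

theorem1p1 : Σ ℕ λ C → 0 < C × ∀ t c → Coprime t c → 1 ≤ c → c < t →
    ∃ λ n → Σ (MGraph (suc n)) λ G → Σ (Simple G) λ s → Planar G ×
    Σ (Fin (length G)) λ e → ∃₂ λ a b →
    HasTau G a × HasTau (contract G e (Simple.loopless s e)) b ×
    0 < a × b * t ≡ a * c ×
    (suc n * c ≤ C * t ⊎ suc n * (t ∸ c) ≤ C * t ⊎ suc n ≤ C * ⌊log₂ t ⌋)
-- Twice the 802 of `size-bound`: for small `c` the number `a` of shunts is only bounded by `2 * t`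
-- over `c`.
theorem1p1 = 1604 , z<s , λ t c _ 1≤c c<t → construct t c 1≤c c<t (c ℕₚ.<? t ∸ c)
  where
  construct : ∀ t c → 1 ≤ c → c < t → Dec (c < t ∸ c) → _
  -- Resistance at least 1: `a` unit resistors in series leave `r + d` over `d`, which lies in [1,
  -- 2).
  construct t c 1≤c c<t (no c≮d) with euclid c (t ∸ c) (ℕₚ.m<n⇒0<n∸m c<t)
  ... | zero , r , c≡ , r<d = contradiction
    (subst (_< t ∸ c) (sym (trans c≡ (ℕₚ.+-identityʳ r))) r<d) c≮d
  ... | suc a , r , c≡ , r<d = conclude {1604} c<t R size
    where
    d = t ∸ c
    L = ⌊log₂ t ⌋
    c≡′ : r + d + a * d ≡ c
    c≡′ = trans (ℕₚ.+-assoc r d (a * d)) (sym c≡)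
    R : Realisable c d (a + suc L * 400)
    R = recast c≡′ refl (series^ a (bounded (suc L) (ℕₚ.m<n⇒0<n∸m c<t) (ℕₚ.m≤n+m d r)
      (ℕₚ.≤-trans (ℕₚ.+-monoˡ-≤ d (ℕₚ.<⇒≤ r<d)) (ℕₚ.+-monoʳ-≤ d (ℕₚ.m≤m+n d (11 * d))))
      (ℕₚ.≤-<-trans (ℕₚ.m∸n≤m t c) (<2^log₂ t))))
    ad≤c : a * d ≤ c
    ad≤c = ℕₚ.≤-trans (ℕₚ.m≤n+m (a * d) (r + d)) (ℕₚ.≤-reflexive c≡′)
    size = [ (λ n≤ → inj₂ (inj₁ (size-* {a = a} {t = t} n≤ ad≤c
               (ℕₚ.≤-trans (ℕₚ.<⇒≤ c<t) (ℕₚ.m≤m+n t (t + 0))))))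
           , inj₂ ∘ inj₂ ]′
           (size-bound a L (0<log₂ (ℕₚ.≤-<-trans 1≤c c<t)) (Realisable.size≤k R) ℕₚ.≤-refl)
  -- Resistance below 1: shunts of 2 have conductance 1/2, so `2 * (t ∸ c)` is divided by `c`; after
  -- `a` shunts there remains `2 * c` over `c + r`, which lies in (1, 2].
  construct t c 1≤c c<t (yes c<d) with euclid (2 * (t ∸ c)) c 1≤c
  ... | zero , r , 2d≡ , r<c = contradiction
    (ℕₚ.<-trans c<d (ℕₚ.≤-<-trans (ℕₚ.m≤m+n (t ∸ c) (t ∸ c + 0))
      (subst (_< c) (sym (trans 2d≡ (ℕₚ.+-identityʳ r))) r<c))) (ℕₚ.<-irrefl refl)
  ... | suc a , r , 2d≡ , r<c = conclude {1604} c<t R size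
    where
    d = t ∸ c
    L = ⌊log₂ t ⌋
    2c : c + c ≡ 2 * c
    2c = cong (c +_) (sym (ℕₚ.+-identityʳ c))
    r+c≤2c : r + c ≤ 2 * c
    r+c≤2c = ℕₚ.≤-trans (ℕₚ.+-monoˡ-≤ c (ℕₚ.<⇒≤ r<c)) (ℕₚ.≤-reflexive 2c)
    2c≤t : 2 * c ≤ t
    2c≤t = ℕₚ.≤-trans (ℕₚ.≤-reflexive (sym 2c)) (ℕₚ.≤-trans (ℕₚ.+-monoʳ-≤ c (ℕₚ.<⇒≤ c<d))
      (ℕₚ.≤-reflexive (ℕₚ.m+[n∸m]≡n (ℕₚ.<⇒≤ c<t))))
    numerator : ∀ c → 2 * (2 * c) ≡ 4 * c
    numerator = solve-∀
    expand : ∀ r c a → 2 * (r + c) + a * (2 * c) ≡ 2 * (r + (1 + a) * c)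
    expand = solve-∀
    R : Realisable c d (a * 1 + suc L * 400)
    R = reduce 3 (numerator c)
      (trans (expand r c a) (trans (cong (2 *_) (sym 2d≡)) (numerator d)))
      (shunt^ 0 a (bounded (suc L) (ℕₚ.≤-trans 1≤c (ℕₚ.m≤n+m c r)) r+c≤2c
        (ℕₚ.*-mono-≤ (ℕₚ.≤ᵇ⇒≤ 2 13 tt) (ℕₚ.m≤n+m c r))
        (ℕₚ.≤-<-trans (ℕₚ.≤-trans r+c≤2c 2c≤t) (<2^log₂ t))))
    ac≤2d : a * c ≤ 2 * d
    ac≤2d = ℕₚ.≤-trans (ℕₚ.m≤n+m (a * c) c)
      (ℕₚ.≤-trans (ℕₚ.m≤n+m (suc a * c) r) (ℕₚ.≤-reflexive (sym 2d≡)))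
    size = [ (λ n≤ → inj₁ (size-* {a = a} {t = t} n≤ ac≤2d (ℕₚ.*-monoʳ-≤ 2 (ℕₚ.m∸n≤m t c))))
           , inj₂ ∘ inj₂ ]′
           (size-bound a L (0<log₂ (ℕₚ.≤-<-trans 1≤c c<t)) (Realisable.size≤k R)
             (ℕₚ.+-monoˡ-≤ (suc L * 400) (ℕₚ.≤-reflexive (ℕₚ.*-identityʳ a))))
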